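{- Let $X$ be a set of $2n$ variables and $\mathbb{F}$ a field. For any full max-rank homogeneous polynomial $f$ of degree $n$ over $X$ and $\mathbb{F}$, the size of any partitioned ABP computing $f$ is $2^{\Omega(n)}$.
   Context: Polynomial coefficient matrix: for disjoint sets of variables $Y,Z$ and $f\in\mathbb{F}[Y,Z]$, $M_f$ has rows indexed by monic multilinear monomials $p$ in $Y$ and columns by monic multilinear monomials $q$ in $Z$, with $M_f(p,q)=G$ where $f$ is uniquely written as $f=pq\,G+Q$ with $G$ containing only variables appearing in $pq$ and $Q$ having no monomial divisible by $pq$ containing only variables appearing in $pq$. $\mathrm{maxrank}(M_f)=\max_{S:Y\cup Z\to\mathbb{F}}\mathrm{rank}(M_f|_S)$. With $X=\{x_1,\dots,x_{2n}\}$, $Y=\{y_1,\dots,y_n\}$, $Z=\{z_1,\dots,z_n\}$, $f$ is full max-rank if $\mathrm{maxrank}(M_{f^A})=2^n$ for every bijection $A:X\to Y\cup Z$ ($f^A$: substitute $A(x)$ for $x$). An arithmetic branching program (ABP) is $B=(G,w,s,t)$ with $G=(V,E)$ a DAG whose vertices are partitioned into levels $L_0=\{s\},L_1,\dots,L_D=\{t\}$, edges only between consecutive levels, and edge weights $w$; for a path $p$, $w(p)=\prod_{e\in p}w(e)$; $B$ computes $\sum_{p\in P_{s,t}}w(p)$ where $P_{i,j}$ is the set of paths from $i$ to $j$; size is $|V|$. It is homogeneous if every edge weight is a homogeneous linear form. $X_{i,j}$ denotes the set of variables occurring on paths in $P_{i,j}$. A homogeneous ABP $B$ over $X$ is $\pi$-partitioned,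 for a permutation $\pi$ of $[2n]$, if there is a level $i=2\alpha n$, for some constant $\alpha>0$, such that every $v\in L_i$ satisfies either ($X_{s,v}\subseteq\{x_{\pi(1)},\dots,x_{\pi(n)}\}$ and $|X_{v,t}|\le 2n(1-\alpha)$) or ($X_{v,t}\subseteq\{x_{\pi(n+1)},\dots,x_{\pi(2n)}\}$ and $|X_{s,v}|\le 2n(1-\alpha)$). $B$ is partitioned if it is $\pi$-partitioned for some $\pi$. The constant in $\Omega(\cdot)$ may depend on $\alpha$. -}

module Defs where

open import Algebra.Apartness.Bundles using (HeytingField; HeytingCommutativeRing)
open import Algebra.Bundles using (CommutativeRing; CommutativeSemiring)
import Algebra.Definitions.RawSemiring as RawSemiringDefinitions
open import Data.Bool.Base using (Bool; T; if_then_else_)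
open import Data.Bool.Properties using (T?; T-irrelevant)
open import Data.Empty using (⊥)
open import Data.Fin.Base using (Fin; toℕ)
import Data.Fin.Properties as Fin
open import Data.Fin.Permutation using (Permutation; Permutation′; _⟨$⟩ʳ_; _⟨$⟩ˡ_)
open import Data.Fin.Subset using (Subset; _∈_; ∣_∣)
open import Data.Fin.Subset.Properties using (_∈?_)
open import Data.Integer.Base as ℤ using (+_)
open import Data.List.Base as List using (List; []; _∷_; _++_; [_])
open import Data.List.Membership.Propositional using () renaming (_∈_ to _∈ₗ_)
import Data.List.Membership.Propositional.Properties as List
open import Data.List.Relation.Unary.All as All using (All; []; _∷_)
import Data.List.Relation.Unary.All.Properties as All
import Data.List.Relation.Unary.AllPairs as AllPairs
import Data.List.Relation.Unary.AllPairs.Properties as AllPairs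
open import Data.List.Relation.Unary.Any using (here)
open import Data.List.Relation.Unary.Unique.Propositional using (Unique; []; _∷_)
import Data.List.Relation.Unary.Unique.Propositional.Properties as Unique
open import Data.Nat.Base as ℕ using (ℕ; zero; suc; _∸_)
import Data.Nat.Properties as ℕ
open import Data.Product.Base using (Σ; ∃-syntax; _×_; _,_; proj₁; proj₂; map₂)
open import Data.Rational.Base as ℚ using (ℚ; ↥_; ↧ₙ_; 1ℚ)
open import Data.Sum.Base using (_⊎_)
open import Data.Vec.Base as Vec using (Vec; lookup; tabulate; zipWith)
import Data.Vec.Properties as Vec
open import Function.Bundles using (_⇔_)
open import Level using (_⊔_)
open import Relation.Binary.Definitions using (DecidableEquality)
open import Relation.Binary.PropositionalEquality.Core as ≡ using (_≡_; refl)
open import Relation.Nullary using (¬_; Dec; yes; no; does; contradiction)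
open import Relation.Nullary.Decidable using (_×-dec_; _→-dec_; ¬?)

ℕ→ℚ : ℕ → ℚ
ℕ→ℚ k = + k ℚ./ 1

-- 2^(κ·n) ≤ s for a rational κ ≥ 0, with the denominator of κ cleared.
2^[_·_]≤_ : ℚ → ℕ → ℕ → Set
2^[ κ · n ]≤ s = 2 ℕ.^ (ℤ.∣ ↥ κ ∣ ℕ.* n) ℕ.≤ s ℕ.^ (↧ₙ κ)

-- Exponent vectors.
Monomial : ℕ → Set
Monomial = Vec ℕ

module _ {m : ℕ} where

  _≟ᵐ_ : DecidableEquality (Monomial m)
  _≟ᵐ_ = Vec.≡-dec ℕ._≟_

  _·ᵐ_ : Monomial m → Monomial m → Monomial m
  _·ᵐ_ = zipWith ℕ._+_

  _∣ᵐ_ : Monomial m → Monomial m → Set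
  β ∣ᵐ γ = ∀ x → lookup β x ℕ.≤ lookup γ x

  -- A monic multilinear monomial is given by the set of its variables.
  multilinear : Subset m → Monomial m
  multilinear = Vec.map (λ b → if b then 1 else 0)

  OnlyVars : Subset m → Monomial m → Set
  OnlyVars u β = ∀ x → 0 ℕ.< lookup β x → x ∈ u

  _∣ᵐ?_ : ∀ β γ → Dec (β ∣ᵐ γ)
  β ∣ᵐ? γ = Fin.all? λ x → lookup β x ℕ.≤? lookup γ x

  onlyVars? : ∀ u β → Dec (OnlyVars u β)
  onlyVars? u β = Fin.all? λ x → (0 ℕ.<? lookup β x) →-dec (x ∈? u)

  ·ᵐ-cancelˡ : ∀ β {γ δ : Monomial m} → β ·ᵐ γ ≡ β ·ᵐ δ → γ ≡ δ
  ·ᵐ-cancelˡ β {γ} {δ} eq = ≡.trans (≡.sym (Vec.tabulate∘lookup γ))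
    (≡.trans (Vec.tabulate-cong λ x → ℕ.+-cancelˡ-≡ (lookup β x) _ _
      (≡.trans (≡.sym (Vec.lookup-zipWith ℕ._+_ x β γ))
        (≡.trans (≡.cong (λ v → lookup v x) eq) (Vec.lookup-zipWith ℕ._+_ x β δ))))
      (Vec.tabulate∘lookup δ))

  ·ᵐ-∸ : ∀ {β γ : Monomial m} → β ∣ᵐ γ → β ·ᵐ zipWith _∸_ γ β ≡ γ
  ·ᵐ-∸ {β} {γ} β∣γ = ≡.trans (≡.sym (Vec.tabulate∘lookup _))
    (≡.trans (Vec.tabulate-cong λ x →
      ≡.trans (Vec.lookup-zipWith ℕ._+_ x β _)
        (≡.trans (≡.cong (lookup β x ℕ.+_) (Vec.lookup-zipWith _∸_ x γ β))
          (ℕ.m+[n∸m]≡n (β∣γ x))))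
      (Vec.tabulate∘lookup γ))

-- Heyting fields are the library's fields.  Classically these are exactly
-- the fields, with x # y meaning x ≠ y; "nonzero" is read as # 0# throughout.
module OverField {c ℓ₁ ℓ₂} (F : HeytingField c ℓ₁ ℓ₂) where

  open HeytingField F
    using (Carrier; _≈_; _#_; _+_; _*_; 0#; 1#; heytingCommutativeRing)
  open HeytingCommutativeRing heytingCommutativeRing using (commutativeRing)
  private module K = CommutativeRing commutativeRing
  open RawSemiringDefinitions (CommutativeSemiring.rawSemiring K.commutativeSemiring)
    using (_^_; sum; product)

  -- A list of terms; only the coefficients are significant, so terms may
  -- repeat or vanish, and equality is _≈ₚ_.
  Poly : ℕ → Set c
  Poly m = List (Carrier × Monomial m)

  module _ {m : ℕ} where

    coeff : Poly m → Monomial m → Carrier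
    coeff []            γ = 0#
    coeff ((a , α) ∷ f) γ = (if does (α ≟ᵐ γ) then a else 0#) + coeff f γ

    infix 4 _≈ₚ_
    _≈ₚ_ : Poly m → Poly m → Set ℓ₁
    f ≈ₚ g = ∀ γ → coeff f γ ≈ coeff g γ

    infixl 6 _+ₚ_
    _+ₚ_ : Poly m → Poly m → Poly m
    _+ₚ_ = _++_

    infixl 7 _*ₚ_
    _*ₚ_ : Poly m → Poly m → Poly m
    _*ₚ_ = List.cartesianProductWith λ (a , α) (b , β) → a * b , α ·ᵐ β

    0ₚ 1ₚ : Poly m
    0ₚ = []
    1ₚ = [ 1# , Vec.replicate m 0 ]

    monomial : Monomial m → Poly m
    monomial α = [ 1# , α ]

    _∈ₚ_ : Monomial m → Poly m → Set ℓ₂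
    γ ∈ₚ f = coeff f γ # 0#

    Occurs : Fin m → Poly m → Set ℓ₂
    Occurs x f = ∃[ γ ] (γ ∈ₚ f × 0 ℕ.< lookup γ x)

    Homogeneous : ℕ → Poly m → Set ℓ₂
    Homogeneous d f = ∀ γ → γ ∈ₚ f → Vec.sum γ ≡ d

    eval : (Fin m → Carrier) → Poly m → Carrier
    eval S []            = 0#
    eval S ((a , α) ∷ f) = a * product (λ x → S x ^ lookup α x) + eval S f

  -- f^A: the exponent of A(x) after the substitution is that of x before.
  rename : ∀ {m k} → Permutation m k → Poly m → Poly k
  rename A = List.map (map₂ λ α → tabulate λ y → lookup α (A ⟨$⟩ˡ y))

  -- f = u·G + Q, where u stands for the multilinear monomial on u.
  record Splitting {m} (f : Poly m) (u : Subset m) : Set (c ⊔ ℓ₁ ⊔ ℓ₂) where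
    field
      G Q    : Poly m
      splits : f ≈ₚ monomial (multilinear u) *ₚ G +ₚ Q
      G-only : ∀ x → Occurs x G → x ∈ u
      Q-none : ∀ γ → γ ∈ₚ Q → ¬ (multilinear u ∣ᵐ γ × OnlyVars u γ)

  module _ {m : ℕ} where

    Inner : Subset m → Carrier × Monomial m → Set
    Inner u (_ , γ) = multilinear u ∣ᵐ γ × OnlyVars u γ

    inner? : ∀ u t → Dec (Inner u t)
    inner? u (_ , γ) = (multilinear u ∣ᵐ? γ) ×-dec onlyVars? u γ

    divideBy : Subset m → Carrier × Monomial m → Carrier × Monomial m
    divideBy u = map₂ λ γ → zipWith _∸_ γ (multilinear u)

    term-≈ : ∀ {a b} (α γ : Monomial m) → a ≈ b →
             (if does (α ≟ᵐ γ) then a else 0#) ≈ (if does (α ≟ᵐ γ) then b else 0#)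
    term-≈ α γ a≈b with does (α ≟ᵐ γ)
    ... | Bool.true  = a≈b
    ... | Bool.false = K.refl

    coeff-insert : ∀ (f : Poly m) t {g} γ →
                   coeff (t ∷ (f ++ g)) γ ≈ coeff (f ++ t ∷ g) γ
    coeff-insert []      t γ = K.refl
    coeff-insert (_ ∷ f) t γ = K.trans (K.sym (K.+-assoc _ _ _))
      (K.trans (K.+-congʳ (K.+-comm _ _))
        (K.trans (K.+-assoc _ _ _) (K.+-congˡ (coeff-insert f t γ))))

    coeff-absent : ∀ {f : Poly m} {γ} → All (λ t → ¬ proj₂ t ≡ γ) f → coeff f γ ≈ 0#
    coeff-absent []                          = K.refl
    coeff-absent {(_ , α) ∷ _} {γ} (α≢γ ∷ h) with α ≟ᵐ γ
    ... | yes α≡γ = contradiction α≡γ α≢γ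
    ... | no  _   = K.trans (K.+-identityˡ _) (coeff-absent h)

    coeff-++ : ∀ (f : Poly m) {g} γ → coeff (f ++ g) γ ≈ coeff f γ + coeff g γ
    coeff-++ []      γ = K.sym (K.+-identityˡ _)
    coeff-++ (_ ∷ f) γ = K.trans (K.+-congˡ (coeff-++ f γ)) (K.sym (K.+-assoc _ _ _))

    coeff-monomial* : ∀ β (f : Poly m) γ → coeff (monomial β *ₚ f) (β ·ᵐ γ) ≈ coeff f γ
    coeff-monomial* β []            γ = K.refl
    coeff-monomial* β ((a , α) ∷ f) γ =
      K.+-cong same (coeff-monomial* β f γ)
      where
      same : (if does ((β ·ᵐ α) ≟ᵐ (β ·ᵐ γ)) then 1# * a else 0#)
           ≈ (if does (α ≟ᵐ γ) then a else 0#)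
      same with (β ·ᵐ α) ≟ᵐ (β ·ᵐ γ) | α ≟ᵐ γ
      ... | yes _ | yes _ = K.*-identityˡ a
      ... | no  _ | no  _ = K.refl
      ... | yes p | no ¬q = contradiction (·ᵐ-cancelˡ β p) ¬q
      ... | no ¬p | yes q = contradiction (≡.cong (β ·ᵐ_) q) ¬p

    module _ (u : Subset m) {P : Carrier × Monomial m → Set} (P? : ∀ t → Dec (P t)) where

      quotient rest : Poly m → Poly m
      quotient f = List.map (divideBy u) (List.filter P? f)
      rest     f = List.filter (λ t → ¬? (P? t)) f

      quotient-rest : (∀ {t} → P t → multilinear u ∣ᵐ proj₂ t) →
                      ∀ f → f ≈ₚ monomial (multilinear u) *ₚ quotient f +ₚ rest f
      quotient-rest P⇒∣ []              γ = K.refl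
      quotient-rest P⇒∣ (t@(a , α) ∷ f) γ with P? t
      ... | yes Pt = K.+-cong
              (K.trans (term-≈ α γ (K.sym (K.*-identityˡ a)))
                (K.reflexive (≡.cong (λ β → if does (β ≟ᵐ γ) then 1# * a else 0#)
                  (≡.sym (·ᵐ-∸ {β = multilinear u} {γ = α} (P⇒∣ Pt))))))
              (quotient-rest P⇒∣ f γ)
      ... | no  _  = K.trans (K.+-congˡ (quotient-rest P⇒∣ f γ))
              (coeff-insert (monomial (multilinear u) *ₚ quotient f) t γ)

    split : (f : Poly m) (u : Subset m) → Splitting f u
    split f u = record
      { G      = quotient u (inner? u) f
      ; Q      = rest u (inner? u) f
      ; splits = quotient-rest u (inner? u) proj₁ f
      ; G-only = G-only
      ; Q-none = λ γ γ∈Q inner → HeytingField.#-irrefl F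
          (coeff-absent (All.map (λ ¬in → λ { refl → ¬in inner })
            (All.all-filter (λ t → ¬? (inner? u t)) f))) γ∈Q
      }
      where
      only : ∀ t → Inner u t → OnlyVars u (proj₂ (divideBy u t))
      only (_ , γ) (_ , h) x 0<γx = h x (ℕ.<-≤-trans 0<γx
        (ℕ.≤-trans (ℕ.≤-reflexive (Vec.lookup-zipWith _∸_ x γ (multilinear u)))
          (ℕ.m∸n≤m (lookup γ x) (lookup (multilinear u) x))))

      G-only : ∀ x → Occurs x (quotient u (inner? u) f) → x ∈ u
      G-only x (γ , γ∈G , 0<γx) with x ∈? u
      ... | yes x∈u = x∈u
      ... | no  x∉u = contradiction γ∈G (HeytingField.#-irrefl F
        (coeff-absent (All.map⁺ (All.map
          (λ {t} inner → λ { refl → x∉u (only t inner x 0<γx) })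
          (All.all-filter (inner? u) f)))))

    split-unique : ∀ {f : Poly m} {u} (s s′ : Splitting f u) →
                   Splitting.G s ≈ₚ Splitting.G s′
    split-unique {f} {u} s s′ γ with onlyVars? u γ
    ... | yes γ⊆u = K.trans (K.sym (coeff-f s)) (coeff-f s′)
      where
      χ : Monomial m
      χ = multilinear u

      inner : χ ∣ᵐ (χ ·ᵐ γ) × OnlyVars u (χ ·ᵐ γ)
      inner = (λ x → ℕ.≤-trans (ℕ.m≤m+n _ _)
                 (ℕ.≤-reflexive (≡.sym (Vec.lookup-zipWith ℕ._+_ x χ γ))))
            , only
        where
        only : OnlyVars u (χ ·ᵐ γ)
        only x 0< with x ∈? u
        ... | yes x∈u = x∈u
        ... | no  x∉u = γ⊆u x (≡.subst (0 ℕ.<_) (≡.trans (Vec.lookup-zipWith ℕ._+_ x χ γ)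
                (≡.cong (ℕ._+ lookup γ x) χx≡0)) 0<)
          where
          χx≡0 : lookup χ x ≡ 0
          χx≡0 with lookup u x in eq | Vec.lookup-map x (λ b → if b then 1 else 0) u
          ... | Bool.true  | _ = contradiction (Vec.lookup⇒[]= x u eq) x∉u
          ... | Bool.false | e = e

      coeff-f : ∀ (s : Splitting f u) → coeff f (χ ·ᵐ γ) ≈ coeff (Splitting.G s) γ
      coeff-f s = K.trans (splits (χ ·ᵐ γ))
        (K.trans (coeff-++ (monomial χ *ₚ G) (χ ·ᵐ γ))
          (K.trans (K.+-cong (coeff-monomial* χ G γ)
            (proj₁ (HeytingField.tight F _ _) λ h → Q-none (χ ·ᵐ γ) h inner))
            (K.+-identityʳ _)))
        where open Splitting s
    ... | no γ⊈u = K.trans (vanish s) (K.sym (vanish s′))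
      where
      vanish : ∀ (s : Splitting f u) → coeff (Splitting.G s) γ ≈ 0#
      vanish s = proj₁ (HeytingField.tight F _ _) λ h →
        γ⊈u λ x 0<γx → Splitting.G-only s x (γ , h , 0<γx)

  -- M_f(p,q).  In Fin (a + b) the variables Y come first, then Z, so the
  -- monomial pq is the concatenation of p and q.
  coeffMatrix : ∀ {a b} → Poly (a ℕ.+ b) → Subset a → Subset b → Poly (a ℕ.+ b)
  coeffMatrix f p q = Splitting.G (split f (p Vec.++ q))

  module _ {i j} {I : Set i} {J : Set j} (M : I → J → Carrier) where

    IndependentColumns : ∀ {k} → (Fin k → J) → Set (c ⊔ ℓ₁ ⊔ i)
    IndependentColumns {k} col = ∀ (a : Fin k → Carrier) →
      (∀ r → sum (λ h → a h * M r (col h)) ≈ 0#) → ∀ h → a h ≈ 0#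

    -- r is the maximal number of linearly independent columns.
    HasRank : ℕ → Set (c ⊔ ℓ₁ ⊔ i ⊔ j)
    HasRank r = (Σ (Fin r → J) IndependentColumns)
              × (∀ {k} (col : Fin k → J) → IndependentColumns col → k ℕ.≤ r)

  HasMaxRank : ∀ {a b} → Poly (a ℕ.+ b) → ℕ → Set (c ⊔ ℓ₁)
  HasMaxRank {a} {b} f r =
      (∃[ S ] HasRank (M∣ S) r) × (∀ S {r′} → HasRank (M∣ S) r′ → r′ ℕ.≤ r)
    where
    M∣ : (Fin (a ℕ.+ b) → Carrier) → Subset a → Subset b → Carrier
    M∣ S p q = eval S (coeffMatrix {a} {b} f p q)

  FullMaxRank : ∀ {n} → Poly (2 ℕ.* n) → Set (c ⊔ ℓ₁)
  FullMaxRank {n} f =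
    ∀ (A : Permutation (2 ℕ.* n) (n ℕ.+ n)) → HasMaxRank {n} {n} (rename A f) (2 ℕ.^ n)

  -- The vertex set is Fin size; acyclicity follows from edge-levels.
  record ABP (m : ℕ) : Set c where
    field
      size depth  : ℕ
      level       : Fin size → Fin (suc depth)
      edge        : Fin size → Fin size → Bool
      weight      : ∀ {u v} → T (edge u v) → Poly m
      s t         : Fin size
      edge-levels : ∀ {u v} → T (edge u v) → toℕ (level v) ≡ suc (toℕ (level u))
      level-s     : ∀ v → toℕ (level v) ≡ 0 ⇔ v ≡ s
      level-t     : ∀ v → toℕ (level v) ≡ depth ⇔ v ≡ t

    data Path : Fin size → Fin size → Set where
      []  : ∀ {u} → Path u u
      _∷_ : ∀ {u v w} → T (edge u v) → Path v w → Path u w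

    pathWeight : ∀ {u w} → Path u w → Poly m
    pathWeight []      = 1ₚ
    pathWeight (e ∷ p) = weight e *ₚ pathWeight p

    OccursOn : ∀ {u w} → Fin m → Path u w → Set ℓ₂
    OccursOn x []      = Level.Lift ℓ₂ ⊥
    OccursOn x (e ∷ p) = Occurs x (weight e) ⊎ OccursOn x p

    -- x ∈ X_{u,w}
    OccursBetween : Fin size → Fin size → Fin m → Set ℓ₂
    OccursBetween u w x = ∃[ p ] OccursOn {u} {w} x p

    pathsOfLength : ℕ → ∀ u w → List (Path u w)
    pathsVia      : ℕ → ∀ u w v → List (Path u w)

    pathsOfLength zero    u w with u Fin.≟ w
    ... | yes refl = [ [] ]
    ... | no  _    = []
    pathsOfLength (suc k) u w = List.concatMap (pathsVia k u w) (List.allFin size)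

    pathsVia k u w v with T? (edge u v)
    ... | yes e = List.map (e ∷_) (pathsOfLength k v w)
    ... | no  _ = []

    -- P_{u,w}, since every path has the length dictated by the levels.
    paths : ∀ u w → List (Path u w)
    paths u w = pathsOfLength (toℕ (level w) ∸ toℕ (level u)) u w

    ∈-paths : ∀ {u w} (p : Path u w) → p ∈ₗ paths u w
    ∈-paths {u} {w} p = ≡.subst (λ k → p ∈ₗ pathsOfLength k u w) (length-level p) (∈-length p)
      where
      length : ∀ {u w} → Path u w → ℕ
      length []      = 0
      length (_ ∷ p) = suc (length p)

      level-length : ∀ {u w} (p : Path u w) →
                     toℕ (level w) ≡ length p ℕ.+ toℕ (level u)
      level-length []              = refl
      level-length {u} (_∷_ e p) = ≡.trans (level-length p)
        (≡.trans (≡.cong (length p ℕ.+_) (edge-levels e)) (ℕ.+-suc _ _))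

      length-level : ∀ {u w} (p : Path u w) →
                     length p ≡ toℕ (level w) ∸ toℕ (level u)
      length-level {u} p = ≡.sym (≡.trans (≡.cong (_∸ toℕ (level u)) (level-length p))
        (ℕ.m+n∸n≡m (length p) (toℕ (level u))))

      ∈-length : ∀ {u w} (p : Path u w) → p ∈ₗ pathsOfLength (length p) u w
      ∈-via    : ∀ {u v w} (e : T (edge u v)) (p : Path v w) →
                 (e ∷ p) ∈ₗ pathsVia (length p) u w v

      ∈-length {u} [] with u Fin.≟ u
      ... | yes refl = here refl
      ... | no  u≢u  = contradiction refl u≢u
      ∈-length {u} {w} (_∷_ {v = v} e p) =
        List.∈-concat⁺′ (∈-via e p) (List.∈-map⁺ (pathsVia (length p) u w) (List.∈-allFin v))

      ∈-via {u} {v} e p with T? (edge u v)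
      ... | yes e′ = ≡.subst (λ e″ → (e″ ∷ p) ∈ₗ List.map (e′ ∷_) (pathsOfLength (length p) v _))
                       (T-irrelevant e′ e) (List.∈-map⁺ (e′ ∷_) (∈-length p))
      ... | no ¬e  = contradiction e ¬e

    paths-unique : ∀ u w → Unique (paths u w)
    paths-unique u w = length-unique (toℕ (level w) ∸ toℕ (level u)) u w
      where
      Via : ∀ {u w} → Fin size → Path u w → Set
      Via v []              = ⊥
      Via v (_∷_ {v = v′} _ _) = v′ ≡ v

      via : ∀ k u w v {p} → p ∈ₗ pathsVia k u w v → Via v p
      via k u w v p∈ with T? (edge u v)
      ... | yes e with List.∈-map⁻ (e ∷_) p∈
      ...   | _ , _ , refl = refl

      distinct : ∀ {u w v v′} (p : Path u w) → Via v p → Via v′ p → v ≡ v′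
      distinct (_ ∷ _) refl refl = refl

      ∷-injective : ∀ {u v w} {e : T (edge u v)} {p q : Path v w} →
                    _≡_ {A = Path u w} (e ∷ p) (e ∷ q) → p ≡ q
      ∷-injective refl = refl

      length-unique : ∀ k u w → Unique (pathsOfLength k u w)
      via-unique    : ∀ k u w v → Unique (pathsVia k u w v)

      length-unique zero    u w with u Fin.≟ w
      ... | yes refl = [] ∷ []
      ... | no  _    = []
      length-unique (suc k) u w = Unique.concat⁺
        (All.map⁺ (All.universal (via-unique k u w) _))
        (AllPairs.map⁺ (AllPairs.map
          (λ v≢v′ → λ { {p} (p∈ , p∈′) →
            v≢v′ (distinct p (via k u w _ p∈) (via k u w _ p∈′)) })
          (Unique.allFin⁺ size)))

      via-unique k u w v with T? (edge u v)
      ... | yes e = Unique.map⁺ ∷-injective (length-unique k v w)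
      ... | no  _ = []

    polynomial : Poly m
    polynomial = List.foldr (λ p f → pathWeight p +ₚ f) 0ₚ (paths s t)

  HomogeneousABP : ∀ {m} → ABP m → Set ℓ₂
  HomogeneousABP B = ∀ {u v} (e : T (edge u v)) → Homogeneous 1 (weight e)
    where open ABP B

  _Computes_ : ∀ {m} → ABP m → Poly m → Set ℓ₁
  B Computes f = ABP.polynomial B ≈ₚ f

  -- |P| ≤ r, for a set P of variables (not assumed decidable) and rational r
  AtMost : ∀ {m ℓ} → (Fin m → Set ℓ) → ℚ → Set ℓ
  AtMost {m} P r = ∃[ U ] ((∀ x → P x → x ∈ U) × ℕ→ℚ ∣ U ∣ ℚ.≤ r)

  module _ {n : ℕ} (α : ℚ) (B : ABP (2 ℕ.* n)) where
    open ABP B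

    -- π-partitioned, with Fin (2 * n) numbering [2n] from 0
    PartitionedBy : Permutation′ (2 ℕ.* n) → Set ℓ₂
    PartitionedBy π = ∃[ i ] (ℕ→ℚ (toℕ i) ≡ ℕ→ℚ 2 ℚ.* α ℚ.* ℕ→ℚ n ×
      (∀ v → level v ≡ i →
          ((∀ x → OccursBetween s v x → FirstHalf x) × AtMost (OccursBetween v t) bound)
        ⊎ ((∀ x → OccursBetween v t x → SecondHalf x) × AtMost (OccursBetween s v) bound)))
      where
      FirstHalf SecondHalf : Fin (2 ℕ.* n) → Set
      FirstHalf  x = ∃[ j ] (toℕ j ℕ.< n × x ≡ π ⟨$⟩ʳ j)
      SecondHalf x = ∃[ j ] (n ℕ.≤ toℕ j × x ≡ π ⟨$⟩ʳ j)

      bound : ℚ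
      bound = ℕ→ℚ 2 ℚ.* ℕ→ℚ n ℚ.* (1ℚ ℚ.- α)

    Partitioned : Set ℓ₂
    Partitioned = ∃[ π ] PartitionedBy π

{-# OPTIONS --safe #-}
module Submission where

open import Defs
open import Algebra.Apartness.Bundles using (HeytingField; HeytingCommutativeRing)
open import Algebra.Bundles using (CommutativeRing; CommutativeSemiring)
import Algebra.Apartness.Properties.HeytingCommutativeRing as HeytingProperties
import Algebra.Definitions.RawSemiring as RawSemiringDefinitions
import Algebra.Properties.CommutativeMonoid.Sum as MonoidSum
import Algebra.Properties.CommutativeSemigroup as CommutativeSemigroupProperties
import Algebra.Properties.Monoid.Mult as MonoidMult
import Algebra.Properties.Ring as RingProperties
import Algebra.Properties.Semiring.Sum as SemiringSum
open import Data.Bool.Base using (Bool; true; false; if_then_else_; not; _∧_; _∨_)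
open import Data.Bool.Properties as Bool using (T?)
open import Data.Fin.Base using (Fin; zero; suc; toℕ; splitAt)
import Data.Fin.Properties as Fin
open import Data.Fin.Permutation as Perm using (Permutation; _⟨$⟩ʳ_; _⟨$⟩ˡ_; _∘ₚ_)
open import Data.Fin.Subset using (Subset; _∈_; ∣_∣; _∩_; _∪_; ∁)
open import Data.Fin.Subset.Properties using (_∈?_; p⊆p∪q; q⊆p∪q)
open import Data.Integer.Base as ℤ using (+_; -[1+_])
import Data.Integer.Properties as ℤ
import Data.Integer.Tactic.RingSolver as ℤ-Solver
open import Data.List.Base as List using (List; []; _∷_; _++_; length)
open import Data.List.Membership.Propositional using (find) renaming (_∈_ to _∈ₗ_)
import Data.List.Membership.Propositional.Properties as List
import Data.List.Properties as List
open import Data.List.Relation.Unary.All as All using (All; []; _∷_)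
import Data.List.Relation.Unary.All.Properties as All
open import Data.List.Relation.Unary.Any using (Any; here; there)
open import Data.List.Relation.Unary.Unique.Propositional using (Unique; _∷_)
import Data.List.Relation.Unary.Unique.Propositional.Properties as Unique
open import Data.List.Relation.Unary.Unique.DecPropositional.Properties using (deduplicate-!)
open import Data.Nat.Base as ℕ using (ℕ; zero; suc; _*_; _≤_; _∸_)
import Data.Nat.Properties as ℕ
import Data.Nat.Tactic.RingSolver as ℕ-Solver
open import Data.Product.Base using (∃-syntax; _×_; _,_; proj₁; proj₂; swap)
open import Data.Rational.Base as ℚ using (ℚ; 0ℚ; 1ℚ; _<_; ↥_; ↧ₙ_; mkℚ)
import Data.Rational.Properties as ℚ
open import Data.Rational.Unnormalised.Base as ℚᵘ using (ℚᵘ; mkℚᵘ; 1ℚᵘ)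
import Data.Rational.Unnormalised.Properties as ℚᵘ
open import Data.Sum.Base using (_⊎_; inj₁; inj₂; [_,_]′)
open import Data.Vec.Base as Vec using ([]; _∷_; lookup; tabulate; zipWith)
import Data.Vec.Properties as Vec
open import Function.Base using (_∘_; flip; const)
open import Function.Bundles using (Equivalence)
open import Level using (_⊔_)
import Relation.Binary.Reasoning.Setoid as SetoidReasoning
open import Relation.Binary.PropositionalEquality as ≡ using (_≡_; _≢_; refl)
open import Relation.Nullary using (¬_; Dec; yes; no; does; contradiction)
open import Relation.Nullary.Decidable using (_×-dec_; _→-dec_)

-- Cut the program at the level of its partition, so that f = Σ_v g_v h_v over
-- the vertices v of that level, and send the first half of the variables to Y
-- and the second half to Z.  After evaluation at S the matrix M_f|_S lists the
-- coefficients of f modulo the relations x² = S(x) x, hence is linear in f and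
-- can be studied product by product.  In the first case of the partition g_v
-- involves only Y, and h_v involves the variables of a set U.  Multiplication
-- by g_v is linear on the Y side, so M_{g_v h_v} has rank at most 2^|U ∩ Y|;
-- its nonzero columns are indexed by subsets of U ∩ Z, so the rank is also at
-- most 2^|U ∩ Z|.  The smaller of the two is at most 2^(|U|/2) ≤ 2^(n(1-α)).
-- The second case is the transpose.  Summing over v gives 2^n ≤ size ·
-- 2^(n(1-α)), so κ = α works.

-- Subsets and exponent vectors

choices : Bool → List Bool
choices false = false ∷ []
choices true  = false ∷ true ∷ []

-- Built one coordinate at a time, so that expanding a product of sums yields exactly this list. Its
-- entries index the rank-one terms of the factorisations below.
subsets : ∀ {N} → Subset N → List (Subset N)
subsets []      = List.[ [] ]
subsets (w ∷ W) = List.concatMap (λ b → List.map (b ∷_) (subsets W)) (choices w)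

length-subsets : ∀ {N} (W : Subset N) → length (subsets W) ≡ 2 ℕ.^ ∣ W ∣
length-subsets []          = refl
length-subsets (false ∷ W) = begin
  length (List.map (false ∷_) (subsets W) ++ [])
    ≡⟨ ≡.cong length (List.++-identityʳ (List.map (false ∷_) (subsets W))) ⟩
  length (List.map (false ∷_) (subsets W))       ≡⟨ List.length-map (false ∷_) (subsets W) ⟩
  length (subsets W)                             ≡⟨ length-subsets W ⟩
  2 ℕ.^ ∣ W ∣                                    ∎
  where open ≡.≡-Reasoning
length-subsets (true ∷ W) = begin
  length (List.map (false ∷_) (subsets W) ++ List.map (true ∷_) (subsets W) ++ [])
    ≡⟨ List.length-++ (List.map (false ∷_) (subsets W)) ⟩
  length (List.map (false ∷_) (subsets W)) ℕ.+ length (List.map (true ∷_) (subsets W) ++ [])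
    ≡⟨ ≡.cong₂ ℕ._+_ (half false) (≡.trans (List.length-++ (List.map (true ∷_) (subsets W))) (≡.cong (ℕ._+ 0) (half true))) ⟩
  2 ℕ.^ ∣ true ∷ W ∣ ∎
  where
  open ≡.≡-Reasoning
  half : ∀ b → length (List.map (b ∷_) (subsets W)) ≡ 2 ℕ.^ ∣ W ∣
  half b = ≡.trans (List.length-map (b ∷_) (subsets W)) (length-subsets W)

∣p∩q∣+∣∁p∩q∣≡∣q∣ : ∀ {N} (p q : Subset N) → ∣ p ∩ q ∣ ℕ.+ ∣ ∁ p ∩ q ∣ ≡ ∣ q ∣
∣p∩q∣+∣∁p∩q∣≡∣q∣ []          []          = refl
∣p∩q∣+∣∁p∩q∣≡∣q∣ (true ∷ p)  (true ∷ q)  = ≡.cong suc (∣p∩q∣+∣∁p∩q∣≡∣q∣ p q)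
∣p∩q∣+∣∁p∩q∣≡∣q∣ (true ∷ p)  (false ∷ q) = ∣p∩q∣+∣∁p∩q∣≡∣q∣ p q
∣p∩q∣+∣∁p∩q∣≡∣q∣ (false ∷ p) (true ∷ q)  = ≡.trans (ℕ.+-suc _ _) (≡.cong suc (∣p∩q∣+∣∁p∩q∣≡∣q∣ p q))
∣p∩q∣+∣∁p∩q∣≡∣q∣ (false ∷ p) (false ∷ q) = ∣p∩q∣+∣∁p∩q∣≡∣q∣ p q

·ᵐ-assoc : ∀ {m} (β γ δ : Monomial m) → (β ·ᵐ γ) ·ᵐ δ ≡ β ·ᵐ (γ ·ᵐ δ)
·ᵐ-assoc = Vec.zipWith-assoc ℕ.+-assoc

·ᵐ-comm : ∀ {m} (β γ : Monomial m) → β ·ᵐ γ ≡ γ ·ᵐ β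
·ᵐ-comm = Vec.zipWith-comm ℕ.+-comm

·ᵐ-onlyVars : ∀ {m} {U : Subset m} β γ → OnlyVars U β → OnlyVars U γ → OnlyVars U (β ·ᵐ γ)
·ᵐ-onlyVars β γ β⊆U γ⊆U x 0<βγ with lookup β x in βx | lookup γ x in γx | Vec.lookup-zipWith ℕ._+_ x β γ
... | suc _ | _     | _  = β⊆U x (≡.subst (0 ℕ.<_) (≡.sym βx) ℕ.z<s)
... | zero  | suc _ | _  = γ⊆U x (≡.subst (0 ℕ.<_) (≡.sym γx) ℕ.z<s)
... | zero  | zero  | eq = contradiction (≡.subst (0 ℕ.<_) eq 0<βγ) λ ()

∉⇒exponent-0 : ∀ {m} {U : Subset m} {β} → OnlyVars U β → ∀ x → lookup U x ≡ false → lookup β x ≡ 0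
∉⇒exponent-0 {U = U} {β} β⊆U x x∉U with lookup β x in eq
... | zero  = refl
... | suc _ = contradiction (≡.trans (≡.sym (Vec.[]=⇒lookup (β⊆U x (≡.subst (0 ℕ.<_) (≡.sym eq) ℕ.z<s)))) x∉U) λ ()

-- From the rational bound on variables to powers of two

toℚᵘ-ℕ→ℚ : ∀ k → ℚ.toℚᵘ (ℕ→ℚ k) ℚᵘ.≃ mkℚᵘ (+ k) 0
toℚᵘ-ℕ→ℚ k = ℚ.toℚᵘ-fromℚᵘ (mkℚᵘ (+ k) 0)

-- With α = a/b, the bound on u is multiplied by b and the term in a moved to the left, so that no
-- truncated subtraction occurs. Unnormalised rationals are used because their numerators and
-- denominators are literal products, free of gcds.
clear-denominators : ∀ α n u → 0ℚ < α → ℕ→ℚ u ℚ.≤ ℕ→ℚ 2 ℚ.* ℕ→ℚ n ℚ.* (1ℚ ℚ.- α) →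
                     u * ↧ₙ α ℕ.+ 2 * n * ℤ.∣ ↥ α ∣ ≤ 2 * n * ↧ₙ α
clear-denominators (mkℚ -[1+ _ ] _ _) n u (ℚ.*<* ()) _
clear-denominators α@(mkℚ (+ a) d _)  n u _ u≤ = ℤ.drop‿+≤+ (begin
  + (u * b ℕ.+ 2 * n * a)
    ≡⟨ ≡.cong₂ ℤ._+_ (ℤ.pos-* u b) (≡.trans (ℤ.pos-* (2 * n) a) (≡.cong (ℤ._* + a) (ℤ.pos-* 2 n))) ⟩
  + u ℤ.* + b ℤ.+ + 2 ℤ.* + n ℤ.* + a
    ≤⟨ ℤ.+-monoˡ-≤ (+ 2 ℤ.* + n ℤ.* + a) cleared ⟩
  + 2 ℤ.* + n ℤ.* (+ 1 ℤ.* + b ℤ.+ ℤ.- (+ a) ℤ.* + 1) ℤ.* + 1 ℤ.+ + 2 ℤ.* + n ℤ.* + a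
    ≡⟨ expand (+ n) (+ a) (+ b) ⟩
  + 2 ℤ.* + n ℤ.* + b
    ≡⟨ ≡.sym (≡.trans (ℤ.pos-* (2 * n) b) (≡.cong (ℤ._* + b) (ℤ.pos-* 2 n))) ⟩
  + (2 * n * b) ∎)
  where
  open ℤ.≤-Reasoning
  b : ℕ
  b = suc d

  expand : ∀ n a b → + 2 ℤ.* n ℤ.* (+ 1 ℤ.* b ℤ.+ ℤ.- a ℤ.* + 1) ℤ.* + 1 ℤ.+ + 2 ℤ.* n ℤ.* a ≡ + 2 ℤ.* n ℤ.* b
  expand = ℤ-Solver.solve-∀

  bound : ℚᵘ
  bound = mkℚᵘ (+ 2) 0 ℚᵘ.* mkℚᵘ (+ n) 0 ℚᵘ.* (1ℚᵘ ℚᵘ.+ ℚᵘ.- mkℚᵘ (+ a) d)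

  bound-≃ : ℚ.toℚᵘ (ℕ→ℚ 2 ℚ.* ℕ→ℚ n ℚ.* (1ℚ ℚ.- α)) ℚᵘ.≃ bound
  bound-≃ = ℚᵘ.≃-trans (ℚ.toℚᵘ-homo-* (ℕ→ℚ 2 ℚ.* ℕ→ℚ n) (1ℚ ℚ.- α)) (ℚᵘ.*-cong
    (ℚᵘ.≃-trans (ℚ.toℚᵘ-homo-* (ℕ→ℚ 2) (ℕ→ℚ n)) (ℚᵘ.*-cong (toℚᵘ-ℕ→ℚ 2) (toℚᵘ-ℕ→ℚ n)))
    (ℚᵘ.≃-trans (ℚ.toℚᵘ-homo-+ 1ℚ (ℚ.- α)) (ℚᵘ.+-congʳ 1ℚᵘ (ℚ.toℚᵘ-homo‿- α))))

  u≤bound : mkℚᵘ (+ u) 0 ℚᵘ.≤ bound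
  u≤bound = ℚᵘ.≤-respˡ-≃ (toℚᵘ-ℕ→ℚ u) (ℚᵘ.≤-respʳ-≃ bound-≃ (ℚ.toℚᵘ-mono-≤ u≤))

  denominator : ℚᵘ.↧ bound ≡ + b
  denominator = ≡.cong (λ k → + suc k) (≡.trans (ℕ.+-identityʳ _) (ℕ.+-identityʳ d))

  cleared : + u ℤ.* + b ℤ.≤ + 2 ℤ.* + n ℤ.* (+ 1 ℤ.* + b ℤ.+ ℤ.- (+ a) ℤ.* + 1) ℤ.* + 1
  cleared = ≡.subst (λ d → + u ℤ.* d ℤ.≤ ℚᵘ.↥ bound ℤ.* + 1) denominator (ℚᵘ.drop-*≤* u≤bound)

^-distribʳ-* : ∀ b s k → (s * k) ℕ.^ b ≡ s ℕ.^ b * k ℕ.^ b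
^-distribʳ-* zero    s k = refl
^-distribʳ-* (suc b) s k = ≡.trans (≡.cong (s * k *_) (^-distribʳ-* b s k))
  (ℕ.[m*n]*[o*p]≡[m*o]*[n*p] s k (s ℕ.^ b) (k ℕ.^ b))

-- k ≤ 2^(n(1-α)), raised to the denominator of α and cleared of subtraction.
^-Bound : ℚ → ℕ → ℕ → Set
^-Bound α n k = 2 ℕ.^ (ℤ.∣ ↥ α ∣ * n) * k ℕ.^ ↧ₙ α ≤ 2 ℕ.^ (n * ↧ₙ α)

^-bound : ∀ α n u k → 0ℚ < α → ℕ→ℚ u ℚ.≤ ℕ→ℚ 2 ℚ.* ℕ→ℚ n ℚ.* (1ℚ ℚ.- α) →
          2 * k ≤ u → ^-Bound α n (2 ℕ.^ k)
^-bound α n u k 0<α u≤ 2k≤u = begin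
  2 ℕ.^ (a * n) * (2 ℕ.^ k) ℕ.^ b ≡⟨ ≡.cong (2 ℕ.^ (a * n) *_) (ℕ.^-*-assoc 2 k b) ⟩
  2 ℕ.^ (a * n) * 2 ℕ.^ (k * b)   ≡⟨ ≡.sym (ℕ.^-distribˡ-+-* 2 (a * n) (k * b)) ⟩
  2 ℕ.^ (a * n ℕ.+ k * b)         ≤⟨ ℕ.^-monoʳ-≤ 2 exponents ⟩
  2 ℕ.^ (n * b)                   ∎
  where
  open ℕ.≤-Reasoning
  a b : ℕ
  a = ℤ.∣ ↥ α ∣
  b = ↧ₙ α

  -- The hypotheses bound 2k rather than k, so the inequality of exponents is proved doubled and the
  -- factor 2 is cancelled afterwards.
  doubled : 2 * (a * n ℕ.+ k * b) ≤ 2 * (n * b)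
  doubled = begin
    2 * (a * n ℕ.+ k * b)     ≡⟨ rearrange a n k b ⟩
    2 * k * b ℕ.+ 2 * n * a   ≤⟨ ℕ.+-monoˡ-≤ (2 * n * a) (ℕ.*-monoˡ-≤ b 2k≤u) ⟩
    u * b ℕ.+ 2 * n * a       ≤⟨ clear-denominators α n u 0<α u≤ ⟩
    2 * n * b                 ≡⟨ ℕ.*-assoc 2 n b ⟩
    2 * (n * b)               ∎
    where
    rearrange : ∀ a n k b → 2 * (a * n ℕ.+ k * b) ≡ 2 * k * b ℕ.+ 2 * n * a
    rearrange = ℕ-Solver.solve-∀

  exponents : a * n ℕ.+ k * b ≤ n * b
  exponents = ℕ.*-cancelˡ-≤ 2 doubled

-- Serves the zero matrices: vertices off the cut level and the empty sum.
^-bound-0 : ∀ α n → ^-Bound α n 0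
^-bound-0 α n = ≡.subst (_≤ 2 ℕ.^ (n * ↧ₙ α)) (≡.sym (ℕ.*-zeroʳ (2 ℕ.^ (ℤ.∣ ↥ α ∣ * n)))) ℕ.z≤n

-- With α = a/b, raise 2^n ≤ s k to the power b, multiply by 2^(a n), absorb k^b by `small`, and
-- cancel 2^(n b).
^-bound⇒2^≤ : ∀ α n s k → ^-Bound α n k → 2 ℕ.^ n ≤ s * k → 2^[ α · n ]≤ s
^-bound⇒2^≤ α n s k small 2ⁿ≤sk = ℕ.*-cancelʳ-≤ _ _ (2 ℕ.^ (n * b)) {{ℕ.m^n≢0 2 (n * b)}} (begin
  2 ℕ.^ (a * n) * 2 ℕ.^ (n * b)     ≡⟨ ≡.cong (2 ℕ.^ (a * n) *_) (≡.sym (ℕ.^-*-assoc 2 n b)) ⟩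
  2 ℕ.^ (a * n) * (2 ℕ.^ n) ℕ.^ b   ≤⟨ ℕ.*-monoʳ-≤ (2 ℕ.^ (a * n)) (ℕ.^-monoˡ-≤ b 2ⁿ≤sk) ⟩
  2 ℕ.^ (a * n) * (s * k) ℕ.^ b     ≡⟨ ≡.cong (2 ℕ.^ (a * n) *_) (^-distribʳ-* b s k) ⟩
  2 ℕ.^ (a * n) * (s ℕ.^ b * k ℕ.^ b) ≡⟨ rearrange (2 ℕ.^ (a * n)) (s ℕ.^ b) (k ℕ.^ b) ⟩
  s ℕ.^ b * (2 ℕ.^ (a * n) * k ℕ.^ b) ≤⟨ ℕ.*-monoʳ-≤ (s ℕ.^ b) small ⟩
  s ℕ.^ b * 2 ℕ.^ (n * b)           ∎)
  where
  open ℕ.≤-Reasoning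
  a b : ℕ
  a = ℤ.∣ ↥ α ∣
  b = ↧ₙ α

  rearrange : ∀ x y z → x * (y * z) ≡ y * (x * z)
  rearrange = ℕ-Solver.solve-∀

module LowerBound {c ℓ₁ ℓ₂} (F : HeytingField c ℓ₁ ℓ₂) where

  open HeytingField F using (_#_; tight; #-irrefl; #⇒invertible; heytingCommutativeRing)
  open HeytingCommutativeRing heytingCommutativeRing using (commutativeRing)
  open CommutativeRing commutativeRing renaming (refl to ≈-refl; _*_ to _⊛_; _+_ to _⊞_; -_ to ⊟_) hiding (zero)
  open OverField F
  open RawSemiringDefinitions (CommutativeSemiring.rawSemiring commutativeSemiring) using (_^_; sum; product)
  open RingProperties ring using (-‿distribˡ-*)
  open SetoidReasoning setoid
  open HeytingProperties heytingCommutativeRing using (1#0; x-0≈x)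
  module + = CommutativeSemigroupProperties +-commutativeSemigroup
  module * = CommutativeSemigroupProperties *-commutativeSemigroup
  module Sum = SemiringSum semiring
  module Product = MonoidSum *-commutativeMonoid

  ¬#⇒≈ : ∀ {x y} → ¬ (x # y) → x ≈ y
  ¬#⇒≈ = proj₁ (tight _ _)

  -- Sums over lists

  ∑ : ∀ {a} {A : Set a} → List A → (A → Carrier) → Carrier
  ∑ xs f = List.foldr (λ x s → f x ⊞ s) 0# xs

  module _ {a} {A : Set a} where

    ∑-cong-All : ∀ {f g : A → Carrier} {xs} → All (λ x → f x ≈ g x) xs → ∑ xs f ≈ ∑ xs g
    ∑-cong-All []         = ≈-refl
    ∑-cong-All (eq ∷ eqs) = +-cong eq (∑-cong-All eqs)

    ∑-cong : ∀ {f g : A → Carrier} xs → (∀ x → f x ≈ g x) → ∑ xs f ≈ ∑ xs g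
    ∑-cong xs eq = ∑-cong-All (All.universal eq xs)

    ∑-zero-All : ∀ {f : A → Carrier} {xs} → All (λ x → f x ≈ 0#) xs → ∑ xs f ≈ 0#
    ∑-zero-All []         = ≈-refl
    ∑-zero-All (eq ∷ eqs) = trans (+-cong eq (∑-zero-All eqs)) (+-identityˡ 0#)

    ∑-zero : ∀ {f : A → Carrier} xs → (∀ x → f x ≈ 0#) → ∑ xs f ≈ 0#
    ∑-zero xs eq = ∑-zero-All (All.universal eq xs)

    ∑-++ : ∀ {f : A → Carrier} xs {ys} → ∑ (xs ++ ys) f ≈ ∑ xs f ⊞ ∑ ys f
    ∑-++ []       = sym (+-identityˡ _)
    ∑-++ (x ∷ xs) = trans (+-congˡ (∑-++ xs)) (sym (+-assoc _ _ _))

    ∑-map : ∀ {b} {B : Set b} {f : A → Carrier} (h : B → A) xs → ∑ (List.map h xs) f ≈ ∑ xs (f ∘ h)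
    ∑-map h []       = ≈-refl
    ∑-map h (x ∷ xs) = +-congˡ (∑-map h xs)

    ∑-concatMap : ∀ {b} {B : Set b} {f : A → Carrier} (h : B → List A) xs →
                  ∑ (List.concatMap h xs) f ≈ ∑ xs (λ x → ∑ (h x) f)
    ∑-concatMap h []       = ≈-refl
    ∑-concatMap h (x ∷ xs) = trans (∑-++ (h x)) (+-congˡ (∑-concatMap h xs))

    ∑-+ : ∀ {f g : A → Carrier} xs → ∑ xs (λ x → f x ⊞ g x) ≈ ∑ xs f ⊞ ∑ xs g
    ∑-+ []       = sym (+-identityˡ _)
    ∑-+ (x ∷ xs) = trans (+-congˡ (∑-+ xs)) (+.interchange _ _ _ _)

    *-∑ : ∀ y {f : A → Carrier} xs → y ⊛ ∑ xs f ≈ ∑ xs (λ x → y ⊛ f x)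
    *-∑ y []       = zeroʳ y
    *-∑ y (x ∷ xs) = trans (distribˡ y _ _) (+-congˡ (*-∑ y xs))

    ∑-* : ∀ y {f : A → Carrier} xs → ∑ xs f ⊛ y ≈ ∑ xs (λ x → f x ⊛ y)
    ∑-* y xs = trans (*-comm _ _) (trans (*-∑ y xs) (∑-cong xs λ _ → *-comm _ _))

    ∑-unique : ∀ {f : A → Carrier} {x xs} → Unique xs → x ∈ₗ xs →
               (∀ y → y ≢ x → f y ≈ 0#) → ∑ xs f ≈ f x
    ∑-unique (x∉ ∷ _) (here refl) f≈0 = trans
      (+-congˡ (∑-zero-All (All.map (λ x≢y → f≈0 _ (x≢y ∘ ≡.sym)) x∉))) (+-identityʳ _)
    ∑-unique (y∉ ∷ u) (there x∈) f≈0 = trans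
      (+-cong (f≈0 _ (λ y≡x → All.lookup y∉ x∈ y≡x)) (∑-unique u x∈ f≈0)) (+-identityˡ _)

  ∑-comm : ∀ {a b} {A : Set a} {B : Set b} {f : A → B → Carrier} xs ys →
           ∑ xs (λ x → ∑ ys (f x)) ≈ ∑ ys (λ y → ∑ xs (λ x → f x y))
  ∑-comm []       ys = sym (∑-zero ys λ _ → ≈-refl)
  ∑-comm (x ∷ xs) ys = trans (+-congˡ (∑-comm xs ys)) (sym (∑-+ ys))

  sum-∑ : ∀ {a} {A : Set a} {n} {f : Fin n → A → Carrier} xs →
          sum (λ h → ∑ xs (f h)) ≈ ∑ xs (λ x → sum (λ h → f h x))
  sum-∑ {n = zero}  xs = sym (∑-zero xs λ _ → ≈-refl)
  sum-∑ {n = suc _} {f} xs = trans (+-congˡ (sum-∑ {f = f ∘ suc} xs)) (sym (∑-+ xs))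

  product-zero : ∀ {n} {f : Fin n → Carrier} x → f x ≈ 0# → product f ≈ 0#
  product-zero zero    eq = trans (*-congʳ eq) (zeroˡ _)
  product-zero (suc x) eq = trans (*-congˡ (product-zero x eq)) (zeroʳ _)

  -- The distributive law, one choice per coordinate. Keeping `p` and `q` apart makes each summand a
  -- product of two factors; these become the row and column factors of a rank-one matrix.
  product-expand : ∀ {N} (W : Subset N) {l : Fin N → Carrier} (p q : Fin N → Bool → Carrier) →
    (∀ x → l x ≈ ∑ (choices (lookup W x)) (λ b → p x b ⊛ q x b)) →
    product l ≈ ∑ (subsets W) λ B → product (λ x → p x (lookup B x)) ⊛ product (λ x → q x (lookup B x))
  product-expand []      p q eq = sym (trans (+-identityʳ _) (*-identityˡ _))
  product-expand (w ∷ W) {l} p q eq = begin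
    l zero ⊛ product (l ∘ suc)
      ≈⟨ *-cong (eq zero) (product-expand W (p ∘ suc) (q ∘ suc) (eq ∘ suc)) ⟩
    ∑ (choices w) (λ b → p zero b ⊛ q zero b) ⊛ ∑ (subsets W) (λ B → P B ⊛ Q B)
      ≈⟨ ∑-* _ (choices w) ⟩
    ∑ (choices w) (λ b → (p zero b ⊛ q zero b) ⊛ ∑ (subsets W) (λ B → P B ⊛ Q B))
      ≈⟨ ∑-cong (choices w) (λ b → trans (*-∑ _ (subsets W))
           (trans (∑-cong (subsets W) λ B → *.interchange _ _ _ _)
             (sym (∑-map (b ∷_) (subsets W))))) ⟩
    ∑ (choices w) (λ b → ∑ (List.map (b ∷_) (subsets W)) λ B →
        product (λ x → p x (lookup B x)) ⊛ product (λ x → q x (lookup B x)))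
      ≈⟨ sym (∑-concatMap _ (choices w)) ⟩
    ∑ (subsets (w ∷ W)) (λ B →
        product (λ x → p x (lookup B x)) ⊛ product (λ x → q x (lookup B x))) ∎
    where
    P Q : Subset _ → Carrier
    P B = product λ x → p (suc x) (lookup B x)
    Q B = product λ x → q (suc x) (lookup B x)

  -- A common nontrivial zero of the forms in D cannot be exhibited without
  -- deciding equality in the field, hence the negative statement.
  forms-not-injective : ∀ N (D : List (Fin N → Carrier)) → length D ℕ.< N →
    ¬ (∀ a → All (λ R → sum (λ h → a h ⊛ R h) ≈ 0#) D → ∀ h → a h ≈ 0#)
  forms-not-injective (suc N) D (ℕ.s≤s |D|≤N) inj =
    ¬¬pivot λ pivot → let _ , R∈D , R₀#0 = find pivot in eliminate (List.∈-∃++ R∈D) R₀#0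
    where
    e₀ : Fin (suc N) → Carrier
    e₀ zero    = 1#
    e₀ (suc _) = 0#

    -- Apartness is undecidable, so a pivot exists only up to double negation, which suffices
    -- because the goal is a negation. Without a pivot, tightness makes every first coefficient
    -- zero, and then `e₀` is a nonzero common zero.
    ¬¬pivot : ¬ ¬ Any (λ R → R zero # 0#) D
    ¬¬pivot none = #-irrefl (inj e₀ (All.map (λ {R} → zero-form R) (All.¬Any⇒All¬ D none)) zero) 1#0
      where
      zero-form : ∀ R → ¬ (R zero # 0#) → sum (λ h → e₀ h ⊛ R h) ≈ 0#
      zero-form R ¬# = begin
        1# ⊛ R zero ⊞ sum (λ h → 0# ⊛ R (suc h)) ≈⟨ +-cong (*-identityˡ _) (Sum.sum-cong-≋ λ h → zeroˡ (R (suc h))) ⟩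
        R zero ⊞ sum {N} (λ _ → 0#)              ≈⟨ +-cong (¬#⇒≈ ¬#) (Sum.sum-replicate-zero N) ⟩
        0# ⊞ 0#                                  ≈⟨ +-identityˡ 0# ⟩
        0#                                       ∎

    eliminate : ∀ {Q} → ∃[ D₁ ] ∃[ D₂ ] (D ≡ D₁ ++ Q ∷ D₂) → ¬ (Q zero # 0#)
    eliminate {Q} (D₁ , D₂ , refl) Q₀#0 =
      forms-not-injective N (List.map reduce (D₁ ++ D₂)) shorter λ a zeros h →
        inj (extend a)
          (All.++⁺ (All.++⁻ˡ D₁ (zeros′ a zeros)) (pivot-zero a ∷ All.++⁻ʳ D₁ (zeros′ a zeros)))
          (suc h)
      where
      q⁻¹ : Carrier
      q⁻¹ = proj₁ (#⇒invertible Q₀#0)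

      q⁻¹*q≈1 : q⁻¹ ⊛ Q zero ≈ 1#
      q⁻¹*q≈1 = trans (*-congˡ (sym (x-0≈x (Q zero)))) (proj₁ (proj₂ (#⇒invertible Q₀#0)))

      -- Gaussian elimination: the multiple of `Q` that cancels the first coefficient of `R` is
      -- subtracted, leaving a form in N unknowns.
      reduce : (Fin (suc N) → Carrier) → Fin N → Carrier
      reduce R h = R (suc h) ⊞ (⊟ (q⁻¹ ⊛ R zero)) ⊛ Q (suc h)

      tail· : (Fin N → Carrier) → (Fin (suc N) → Carrier) → Carrier
      tail· a R = sum (λ h → a h ⊛ R (suc h))

      -- The first coordinate is obtained by solving `Q` = 0; on such vectors `R` and `reduce R`
      -- agree.
      extend : (Fin N → Carrier) → Fin (suc N) → Carrier
      extend a zero    = ⊟ (q⁻¹ ⊛ tail· a Q)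
      extend a (suc h) = a h

      reduced : ∀ a R → sum (λ h → extend a h ⊛ R h) ≈ sum (λ h → a h ⊛ reduce R h)
      reduced a R = sym (begin
        sum (λ h → a h ⊛ reduce R h)
          ≈⟨ Sum.sum-cong-≋ (λ h → trans (distribˡ (a h) _ _) (+-congˡ (*.x∙yz≈y∙xz (a h) _ _))) ⟩
        sum (λ h → a h ⊛ R (suc h) ⊞ (⊟ (q⁻¹ ⊛ R zero)) ⊛ (a h ⊛ Q (suc h)))
          ≈⟨ Sum.∑-distrib-+ (λ h → a h ⊛ R (suc h)) _ ⟩
        tail· a R ⊞ sum (λ h → (⊟ (q⁻¹ ⊛ R zero)) ⊛ (a h ⊛ Q (suc h)))
          ≈⟨ +-congˡ (sym (Sum.*-distribˡ-sum _ (λ h → a h ⊛ Q (suc h)))) ⟩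
        tail· a R ⊞ (⊟ (q⁻¹ ⊛ R zero)) ⊛ tail· a Q
          ≈⟨ +-comm _ _ ⟩
        (⊟ (q⁻¹ ⊛ R zero)) ⊛ tail· a Q ⊞ tail· a R
          ≈⟨ +-congʳ (trans (sym (-‿distribˡ-* _ _)) (trans (-‿cong (*.xy∙z≈xz∙y _ _ _)) (-‿distribˡ-* _ _))) ⟩
        (⊟ (q⁻¹ ⊛ tail· a Q)) ⊛ R zero ⊞ tail· a R ∎)

      pivot-zero : ∀ a → sum (λ h → extend a h ⊛ Q h) ≈ 0#
      pivot-zero a = begin
        (⊟ (q⁻¹ ⊛ tail· a Q)) ⊛ Q zero ⊞ tail· a Q
          ≈⟨ +-congʳ (trans (sym (-‿distribˡ-* _ _)) (-‿cong
               (trans (*.xy∙z≈xz∙y _ _ _) (trans (*-congʳ q⁻¹*q≈1) (*-identityˡ _))))) ⟩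
        ⊟ tail· a Q ⊞ tail· a Q
          ≈⟨ -‿inverseˡ _ ⟩
        0# ∎

      zeros′ : ∀ a → All (λ R → sum (λ h → a h ⊛ R h) ≈ 0#) (List.map reduce (D₁ ++ D₂)) →
               All (λ R → sum (λ h → extend a h ⊛ R h) ≈ 0#) (D₁ ++ D₂)
      zeros′ a = All.map (λ {R} → trans (reduced a R)) ∘ All.map⁻

      shorter : length (List.map reduce (D₁ ++ D₂)) ℕ.< N
      shorter = ℕ.≤-trans (ℕ.≤-reflexive (≡.trans (≡.cong suc (≡.trans (List.length-map reduce (D₁ ++ D₂)) (List.length-++ D₁)))
        (≡.sym (≡.trans (List.length-++ D₁) (ℕ.+-suc (length D₁) (length D₂)))))) |D|≤N

  -- Coefficient functionals

  module _ {m : ℕ} where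

    -- The linear functional with value φ on monomials. Term lists may contain repetitions and
    -- cancellations, so polynomials are compared through all such functionals (`_≈ₗ_`), which
    -- handle products without convolutions of coefficients.
    L : (Monomial m → Carrier) → Poly m → Carrier
    L φ f = ∑ f λ t → proj₁ t ⊛ φ (proj₂ t)

    infix 4 _≈ₗ_
    _≈ₗ_ : Poly m → Poly m → Set (c ⊔ ℓ₁)
    f ≈ₗ g = ∀ φ → L φ f ≈ L φ g

    -- The composite of φ with multiplication by g.
    infixl 7 _◃_
    _◃_ : (Monomial m → Carrier) → Poly m → Monomial m → Carrier
    (φ ◃ g) α = L (λ β → φ (α ·ᵐ β)) g

    L-cong : ∀ {φ ψ} f → (∀ α → φ α ≈ ψ α) → L φ f ≈ L ψ f
    L-cong f eq = ∑-cong f λ _ → *-congˡ (eq _)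

    L-cong-All : ∀ {φ ψ} {f} → All (λ t → φ (proj₂ t) ≈ ψ (proj₂ t)) f → L φ f ≈ L ψ f
    L-cong-All = ∑-cong-All ∘ All.map *-congˡ

    L-scaleˡ : ∀ {φ} y f → L (λ α → y ⊛ φ α) f ≈ y ⊛ L φ f
    L-scaleˡ y f = trans (∑-cong f λ _ → *.x∙yz≈y∙xz _ _ _) (sym (*-∑ y f))

    L-scaleʳ : ∀ {φ} y f → L (λ α → φ α ⊛ y) f ≈ L φ f ⊛ y
    L-scaleʳ y f = trans (∑-cong f λ _ → sym (*-assoc _ _ _)) (sym (∑-* y f))

    L-zero : ∀ {φ} f → (∀ α → φ α ≈ 0#) → L φ f ≈ 0#
    L-zero f eq = ∑-zero f λ _ → trans (*-congˡ (eq _)) (zeroʳ _)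

    L-∑ : ∀ {a} {A : Set a} {φ : A → Monomial m → Carrier} xs f →
          L (λ α → ∑ xs (λ x → φ x α)) f ≈ ∑ xs (λ x → L (φ x) f)
    L-∑ xs f = trans (∑-cong f λ _ → *-∑ _ xs) (∑-comm f xs)

    L-*ₚ : ∀ φ f g → L φ (f *ₚ g) ≈ L (φ ◃ g) f
    L-*ₚ φ []            g = ≈-refl
    L-*ₚ φ ((a , α) ∷ f) g = trans (∑-++ (List.map _ g)) (+-cong
      (trans (∑-map _ g) (trans (∑-cong g λ _ → *-assoc a _ _) (sym (*-∑ a g))))
      (L-*ₚ φ f g))

    L-*ₚ-comm : ∀ φ f g → L φ (f *ₚ g) ≈ L φ (g *ₚ f)
    L-*ₚ-comm φ f g = begin
      L φ (f *ₚ g)                            ≈⟨ L-*ₚ φ f g ⟩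
      ∑ f (λ s → proj₁ s ⊛ ∑ g (λ t → proj₁ t ⊛ φ (proj₂ s ·ᵐ proj₂ t)))
        ≈⟨ ∑-cong f (λ _ → *-∑ _ g) ⟩
      ∑ f (λ s → ∑ g (λ t → proj₁ s ⊛ (proj₁ t ⊛ φ (proj₂ s ·ᵐ proj₂ t))))
        ≈⟨ ∑-comm f g ⟩
      ∑ g (λ t → ∑ f (λ s → proj₁ s ⊛ (proj₁ t ⊛ φ (proj₂ s ·ᵐ proj₂ t))))
        ≈⟨ ∑-cong g (λ t → ∑-cong f λ s → trans (*.x∙yz≈y∙xz _ _ _)
             (*-congˡ (*-congˡ (reflexive (≡.cong φ (·ᵐ-comm (proj₂ s) (proj₂ t))))))) ⟩
      ∑ g (λ t → ∑ f (λ s → proj₁ t ⊛ (proj₁ s ⊛ φ (proj₂ t ·ᵐ proj₂ s))))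
        ≈⟨ sym (∑-cong g λ _ → *-∑ _ f) ⟩
      L (φ ◃ f) g                             ≈⟨ sym (L-*ₚ φ g f) ⟩
      L φ (g *ₚ f)                            ∎

    *ₚ-cong : ∀ {f f′ g g′} → f ≈ₗ f′ → g ≈ₗ g′ → f *ₚ g ≈ₗ f′ *ₚ g′
    *ₚ-cong {f} {f′} {g} {g′} f≈ g≈ φ = begin
      L φ (f *ₚ g)   ≈⟨ L-*ₚ φ f g ⟩
      L (φ ◃ g) f    ≈⟨ f≈ (φ ◃ g) ⟩
      L (φ ◃ g) f′   ≈⟨ L-cong f′ (λ _ → g≈ _) ⟩
      L (φ ◃ g′) f′  ≈⟨ sym (L-*ₚ φ f′ g′) ⟩
      L φ (f′ *ₚ g′) ∎

    +ₚ-cong : ∀ {f f′ g g′} → f ≈ₗ f′ → g ≈ₗ g′ → f +ₚ g ≈ₗ f′ +ₚ g′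
    +ₚ-cong {f} {f′} f≈ g≈ φ = trans (∑-++ f) (trans (+-cong (f≈ φ) (g≈ φ)) (sym (∑-++ f′)))

    -- Each term contributes to exactly one entry of `Γ`, since `Γ` contains its monomial once.
    -- Allowing further entries in `Γ` lets two polynomials share one list.
    L-coeff : ∀ φ f {Γ} → Unique Γ → All (λ t → proj₂ t ∈ₗ Γ) f →
              L φ f ≈ ∑ Γ (λ γ → coeff f γ ⊛ φ γ)
    L-coeff φ []            {Γ} u []        = sym (∑-zero Γ λ _ → zeroˡ _)
    L-coeff φ ((a , α) ∷ f) {Γ} u (α∈ ∷ f∈) = sym (begin
      ∑ Γ (λ γ → ((if does (α ≟ᵐ γ) then a else 0#) ⊞ coeff f γ) ⊛ φ γ)
        ≈⟨ ∑-cong Γ (λ γ → distribʳ _ _ _) ⟩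
      ∑ Γ (λ γ → (if does (α ≟ᵐ γ) then a else 0#) ⊛ φ γ ⊞ coeff f γ ⊛ φ γ)
        ≈⟨ ∑-+ Γ ⟩
      ∑ Γ (λ γ → (if does (α ≟ᵐ γ) then a else 0#) ⊛ φ γ) ⊞ ∑ Γ (λ γ → coeff f γ ⊛ φ γ)
        ≈⟨ +-cong (trans (∑-unique u α∈ off) (*-congʳ on)) (sym (L-coeff φ f u f∈)) ⟩
      a ⊛ φ α ⊞ L φ f ∎)
      where
      off : ∀ γ → γ ≢ α → (if does (α ≟ᵐ γ) then a else 0#) ⊛ φ γ ≈ 0#
      off γ γ≢α with α ≟ᵐ γ
      ... | yes α≡γ = contradiction (≡.sym α≡γ) γ≢α
      ... | no  _   = zeroˡ _

      on : (if does (α ≟ᵐ α) then a else 0#) ≈ a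
      on with α ≟ᵐ α
      ... | yes _  = ≈-refl
      ... | no α≢α = contradiction refl α≢α

    ≈ₚ⇒≈ₗ : ∀ {f g} → f ≈ₚ g → f ≈ₗ g
    ≈ₚ⇒≈ₗ {f} {g} f≈g φ = begin
      L φ f                       ≈⟨ L-coeff φ f unique (All.tabulate (∈Γ ∘ List.∈-++⁺ˡ)) ⟩
      ∑ Γ (λ γ → coeff f γ ⊛ φ γ) ≈⟨ ∑-cong Γ (λ γ → *-congʳ (f≈g γ)) ⟩
      ∑ Γ (λ γ → coeff g γ ⊛ φ γ) ≈⟨ sym (L-coeff φ g unique (All.tabulate (∈Γ ∘ List.∈-++⁺ʳ f))) ⟩
      L φ g                       ∎
      where
      Γ : List (Monomial m)
      Γ = List.deduplicate _≟ᵐ_ (List.map proj₂ (f ++ g))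

      unique : Unique Γ
      unique = deduplicate-! _≟ᵐ_ (List.map proj₂ (f ++ g))

      ∈Γ : ∀ {t} → t ∈ₗ f ++ g → proj₂ t ∈ₗ Γ
      ∈Γ = List.∈-deduplicate⁺ _≟ᵐ_ ∘ List.∈-map⁺ proj₂

    Only : Subset m → Poly m → Set c
    Only U = All λ t → OnlyVars U (proj₂ t)

    -- Terms of f outside U may be present provided that they cancel.
    Supported : Subset m → Poly m → Set (c ⊔ ℓ₁)
    Supported U f = ∃[ f′ ] (Only U f′ × f ≈ₗ f′)

    supported-0ₚ : ∀ {U} → Supported U 0ₚ
    supported-0ₚ = [] , [] , λ _ → ≈-refl

    supported-1ₚ : ∀ {U} → Supported U 1ₚ
    supported-1ₚ {U} = 1ₚ
                     , (λ x 0<0 → contradiction (≡.subst (0 ℕ.<_) (Vec.lookup-replicate x 0) 0<0) λ ()) ∷ []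
                     , λ _ → ≈-refl

    supported-+ₚ : ∀ {U f g} → Supported U f → Supported U g → Supported U (f +ₚ g)
    supported-+ₚ {f = f} {g} (f′ , Uf , f≈) (g′ , Ug , g≈) =
      f′ +ₚ g′ , All.++⁺ Uf Ug , +ₚ-cong {f} {f′} {g} {g′} f≈ g≈

    only-*ₚ : ∀ {U f g} → Only U f → Only U g → Only U (f *ₚ g)
    only-*ₚ []          Ug = []
    only-*ₚ {f = (_ , α) ∷ _} (α⊆U ∷ Uf) Ug = All.++⁺ (All.map⁺ (All.map (λ {t} → ·ᵐ-onlyVars α (proj₂ t) α⊆U) Ug)) (only-*ₚ Uf Ug)

    supported-*ₚ : ∀ {U f g} → Supported U f → Supported U g → Supported U (f *ₚ g)
    supported-*ₚ {f = f} {g} (f′ , Uf , f≈) (g′ , Ug , g≈) =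
      f′ *ₚ g′ , only-*ₚ Uf Ug , *ₚ-cong {f} {f′} {g} {g′} f≈ g≈

    coeff-filter : ∀ {P : Monomial m → Set} (P? : ∀ (t : Carrier × Monomial m) → Dec (P (proj₂ t))) {γ} →
                   P γ → ∀ f → coeff f γ ≈ coeff (List.filter P? f) γ
    coeff-filter P? Pγ []            = ≈-refl
    coeff-filter P? {γ} Pγ ((a , α) ∷ f) with P? (a , α)
    ... | yes _  = +-congˡ (coeff-filter P? Pγ f)
    ... | no ¬Pα with α ≟ᵐ γ
    ...   | yes refl = contradiction Pγ ¬Pα
    ...   | no  _    = trans (+-identityˡ _) (coeff-filter P? Pγ f)

    -- If a monomial with a variable outside U had coefficient apart from 0, that variable would
    -- occur in f. By tightness its coefficient is 0, so its terms can be filtered out.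
    supported : ∀ {U} f → (∀ x → Occurs x f → x ∈ U) → Supported U f
    supported {U} f f⊆U = List.filter U? f , All.all-filter U? f , ≈ₚ⇒≈ₗ {f} {List.filter U? f} same
      where
      U? : ∀ t → Dec (OnlyVars U (proj₂ t))
      U? t = onlyVars? U (proj₂ t)

      outside : ∀ {γ} → ¬ OnlyVars U γ → ¬ (coeff f γ # 0#)
      outside γ⊈U fγ#0 = γ⊈U λ x 0<γx → f⊆U x (_ , fγ#0 , 0<γx)

      same : f ≈ₚ List.filter U? f
      same γ with onlyVars? U γ
      ... | yes γ⊆U = coeff-filter U? γ⊆U f
      ... | no  γ⊈U = trans (¬#⇒≈ (outside γ⊈U))
        (sym (coeff-absent (All.map (λ α⊆U → λ { refl → γ⊈U α⊆U }) (All.all-filter U? f))))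

  -- Rank

  -- A sum of k rank-one matrices: "rank at most k" in a form that needs no choice of basis and adds
  -- up directly.
  record Factorisation {I J : Set} (M : I → J → Carrier) (k : ℕ) : Set (c ⊔ ℓ₁) where
    field
      terms   : List ((I → Carrier) × (J → Carrier))
      number  : length terms ≡ k
      factors : ∀ i j → M i j ≈ ∑ terms λ t → proj₁ t i ⊛ proj₂ t j

  open Factorisation

  module _ {I J : Set} where

    factorisation-cong : ∀ {M N : I → J → Carrier} {k} → (∀ i j → M i j ≈ N i j) →
                         Factorisation N k → Factorisation M k
    factorisation-cong eq D = record
      { terms = terms D ; number = number D ; factors = λ i j → trans (eq i j) (factors D i j) }

    factorisation-0 : Factorisation {I} {J} (λ _ _ → 0#) 0
    factorisation-0 = record { terms = [] ; number = refl ; factors = λ _ _ → ≈-refl }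

    factorisation-+ : ∀ {M N : I → J → Carrier} {k l} → Factorisation M k → Factorisation N l →
                      Factorisation (λ i j → M i j ⊞ N i j) (k ℕ.+ l)
    factorisation-+ D E = record
      { terms   = terms D ++ terms E
      ; number  = ≡.trans (List.length-++ (terms D)) (≡.cong₂ ℕ._+_ (number D) (number E))
      ; factors = λ i j → trans (+-cong (factors D i j) (factors E i j)) (sym (∑-++ (terms D)))
      }

    factorisation-transpose : ∀ {M : I → J → Carrier} {k} → Factorisation M k → Factorisation (flip M) k
    factorisation-transpose D = record
      { terms   = List.map swap (terms D)
      ; number  = ≡.trans (List.length-map swap (terms D)) (number D)
      ; factors = λ j i → trans (factors D i j)
          (trans (∑-cong (terms D) λ _ → *-comm _ _) (sym (∑-map swap (terms D))))
      }

    -- The column factors of the k terms give k linear forms in n unknowns. A common zero of them is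
    -- a linear relation among the chosen columns, so independence makes the forms jointly
    -- injective, which is impossible for k < n.
    independent⇒≤ : ∀ {M : I → J → Carrier} {k n} → Factorisation M k →
                    (col : Fin n → J) → IndependentColumns M col → n ℕ.≤ k
    independent⇒≤ {M} {k} {n} D col independent = ℕ.≮⇒≥ λ k<n →
      forms-not-injective n (List.map form (terms D))
        (ℕ.≤-trans (ℕ.≤-reflexive (≡.cong suc (≡.trans (List.length-map form (terms D)) (number D)))) k<n)
        λ a zeros → independent a λ i → begin
          sum (λ h → a h ⊛ M i (col h))
            ≈⟨ Sum.sum-cong-≋ (λ h → trans (*-congˡ (factors D i (col h))) (trans (*-∑ (a h) (terms D))
                 (∑-cong (terms D) λ _ → *.x∙yz≈y∙xz _ _ _))) ⟩
          sum (λ h → ∑ (terms D) (λ t → proj₁ t i ⊛ (a h ⊛ proj₂ t (col h))))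
            ≈⟨ sum-∑ {f = λ h t → proj₁ t i ⊛ (a h ⊛ proj₂ t (col h))} (terms D) ⟩
          ∑ (terms D) (λ t → sum (λ h → proj₁ t i ⊛ (a h ⊛ proj₂ t (col h))))
            ≈⟨ ∑-zero-All (All.map (λ {t} zero-t →
                 trans (sym (Sum.*-distribˡ-sum (proj₁ t i) (λ h → a h ⊛ proj₂ t (col h))))
                   (trans (*-congˡ zero-t) (zeroʳ _))) (All.map⁻ zeros)) ⟩
          0# ∎
      where
      form : (I → Carrier) × (J → Carrier) → Fin n → Carrier
      form t h = proj₂ t (col h)

  -- The rank of a single product

  -- Reducing modulo x² = s x turns every monomial in x into a multiple of
  -- 1 or x; this is the coefficient of 1 (for false) or x (for true).
  w : Carrier → Bool → ℕ → Carrier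
  w s false zero    = 1#
  w s false (suc _) = 0#
  w s true  zero    = 0#
  w s true  (suc k) = s ^ k

  -- The coefficient of the multilinear monomial on `u` in the reduction of `α`. Here `u` is a
  -- function, so that it can be pulled back along a permutation.
  weights : ∀ {N} → (Fin N → Carrier) → (Fin N → Bool) → Monomial N → Carrier
  weights S u α = product λ x → w (S x) (u x) (lookup α x)

  bit : Bool → ℕ
  bit b = if b then 1 else 0

  δ : Bool → Bool → Carrier
  δ b b′ = if does (b Bool.≟ b′) then 1# else 0#

  -- Reduce x^l first to a combination of the x^e with e at most 1, then reduce each x^(k+e).
  w-+ : ∀ s b k l → w s b (k ℕ.+ l) ≈ ∑ (choices true) λ e → w s b (k ℕ.+ bit e) ⊛ w s e l
  w-+ s b k zero = sym (trans (+-cong (*-identityʳ _) (trans (+-identityʳ _) (zeroʳ _))) (+-identityʳ _))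
  w-+ s b k (suc l) = sym (trans (+-cong (zeroʳ _) (+-identityʳ _)) (trans (+-identityˡ _) (split-^ b)))
    where
    split-^ : ∀ b → w s b (k ℕ.+ 1) ⊛ s ^ l ≈ w s b (k ℕ.+ suc l)
    split-^ b rewrite ℕ.+-suc k 0 | ℕ.+-suc k l | ℕ.+-identityʳ k with b
    ... | false = zeroˡ _
    ... | true  = sym (MonoidMult.×-homo-+ *-monoid s k l)

  -- One coordinate of `factor-rows`, with `v` and `o` for membership in V and U. Both factors can
  -- contain the variable only if it lies in V ∩ U; elsewhere one exponent is 0 and the sum has the
  -- single term e = false.
  w-mul : ∀ s v o {b b′ k l} → (v ≡ false → k ≡ 0) → (o ≡ false → l ≡ 0) →
    w s (if v then b else b′) (k ℕ.+ l) ≈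
    ∑ (choices (v ∧ o)) λ e → (if v then w s b (k ℕ.+ bit e) else 1#) ⊛ (if v then w s e l else w s b′ l)
  w-mul s true  true  {b} {k = k} {l}     v⇒ o⇒ = w-+ s b k l
  w-mul s true  false v⇒ o⇒ with refl ← o⇒ refl = sym (trans (+-identityʳ _) (*-identityʳ _))
  w-mul s false o     v⇒ o⇒ with refl ← v⇒ refl = sym (trans (+-identityʳ _) (*-identityˡ _))

  -- One coordinate of `factor-columns`. Off V, `δ` picks out the column bit; off U as well the
  -- exponent is 0, so a column bit true gives 0 on both sides.
  w-select : ∀ s v o {b b′ k} → (v ∨ o ≡ false → k ≡ 0) →
    w s (if v then b else b′) k ≈
    ∑ (choices (not v ∧ o)) λ e → w s (if v then b else e) k ⊛ (if v then 1# else δ e b′)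
  w-select s true  o             _ = sym (trans (+-identityʳ _) (*-identityʳ _))
  w-select s false true  {b′ = false} _ = sym (trans (+-cong (*-identityʳ _) (trans (+-identityʳ _) (zeroʳ _))) (+-identityʳ _))
  w-select s false true  {b′ = true}  _ = sym (trans (+-cong (zeroʳ _) (trans (+-identityʳ _) (*-identityʳ _))) (+-identityˡ _))
  w-select s false false {b′ = b′} vo⇒ with refl ← vo⇒ refl | b′
  ... | false = sym (trans (+-identityʳ _) (*-identityʳ _))
  ... | true  = sym (trans (+-identityʳ _) (zeroʳ _))

  -- Row bits are read on V and column bits off V. Leaving V arbitrary treats both cases of the
  -- partition at once, the second with rows and columns exchanged.
  module _ {N : ℕ} (S : Fin N → Carrier) {I J : Set} (V U : Subset N)
           {r : I → Fin N → Bool} {c : J → Fin N → Bool} {u : I → J → Fin N → Bool}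
           (u≡ : ∀ i j x → u i j x ≡ (if lookup V x then r i x else c j x)) where

    private
      M : Poly N → I → J → Carrier
      M f i j = L (weights S (u i j)) f

    -- After reducing h, multiplication by g acts on the V-part of its monomials alone. That part is
    -- some B in V ∩ U, and B is all that passes between the column and the row.
    factor-rows : ∀ {g h} → Only V g → Only U h → Factorisation (M (g *ₚ h)) (2 ℕ.^ ∣ V ∩ U ∣)
    factor-rows {g} {h} Vg Uh = record
      { terms   = List.map (λ B → (λ i → L (P i B) g) , (λ j → L (Q j B) h)) (subsets (V ∩ U))
      ; number  = ≡.trans (List.length-map _ (subsets (V ∩ U))) (length-subsets (V ∩ U))
      ; factors = λ i j → begin
          L (weights S (u i j)) (g *ₚ h)
            ≈⟨ L-*ₚ _ g h ⟩
          L (weights S (u i j) ◃ h) g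
            ≈⟨ L-cong-All (All.map (λ {s} α⊆V → trans
                 (L-cong-All (All.map (λ {t} → expand i j (proj₂ s) (proj₂ t) α⊆V) Uh))
                 (trans (L-∑ (subsets (V ∩ U)) h) (∑-cong (subsets (V ∩ U)) λ B → L-scaleˡ _ h))) Vg) ⟩
          L (λ α → ∑ (subsets (V ∩ U)) (λ B → P i B α ⊛ L (Q j B) h)) g
            ≈⟨ trans (L-∑ (subsets (V ∩ U)) g) (∑-cong (subsets (V ∩ U)) λ B → L-scaleʳ _ g) ⟩
          ∑ (subsets (V ∩ U)) (λ B → L (P i B) g ⊛ L (Q j B) h)
            ≈⟨ sym (∑-map _ (subsets (V ∩ U))) ⟩
          _ ∎
      }
      where
      -- Applied to g, this is the coefficient of the row monomial in the reduction of g times the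
      -- monomial on B.
      P : I → Subset N → Monomial N → Carrier
      P i B α = product λ x → if lookup V x then w (S x) (r i x) (lookup α x ℕ.+ bit (lookup B x)) else 1#

      -- Applied to h, this is the coefficient of the monomial that is B on V and the column
      -- monomial off V.
      Q : J → Subset N → Monomial N → Carrier
      Q j B β = product λ x → if lookup V x then w (S x) (lookup B x) (lookup β x) else w (S x) (c j x) (lookup β x)

      expand : ∀ i j α β → OnlyVars V α → OnlyVars U β →
               weights S (u i j) (α ·ᵐ β) ≈ ∑ (subsets (V ∩ U)) (λ B → P i B α ⊛ Q j B β)
      expand i j α β α⊆V β⊆U = product-expand (V ∩ U)
        (λ x e → if lookup V x then w (S x) (r i x) (lookup α x ℕ.+ bit e) else 1#)
        (λ x e → if lookup V x then w (S x) e (lookup β x) else w (S x) (c j x) (lookup β x))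
        pointwise
        where
        pointwise : ∀ x → w (S x) (u i j x) (lookup (α ·ᵐ β) x) ≈ ∑ (choices (lookup (V ∩ U) x)) _
        pointwise x rewrite u≡ i j x | Vec.lookup-zipWith ℕ._+_ x α β | Vec.lookup-zipWith _∧_ x V U =
          w-mul (S x) (lookup V x) (lookup U x)
            (∉⇒exponent-0 {β = α} α⊆V x) (∉⇒exponent-0 {β = β} β⊆U x)

    -- A column depends only on its bits off V and vanishes unless these lie in U. So there is one
    -- term for each subset B of the complement of V within U, and `Q j B` tests whether column j
    -- agrees with B off V.
    factor-columns : ∀ {f} → Only (V ∪ U) f → Factorisation (M f) (2 ℕ.^ ∣ ∁ V ∩ U ∣)
    factor-columns {f} VUf = record
      { terms   = List.map (λ B → (λ i → L (P i B) f) , (λ j → Q j B)) (subsets (∁ V ∩ U))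
      ; number  = ≡.trans (List.length-map _ (subsets (∁ V ∩ U))) (length-subsets (∁ V ∩ U))
      ; factors = λ i j → begin
          L (weights S (u i j)) f
            ≈⟨ L-cong-All (All.map (λ {t} → expand i j (proj₂ t)) VUf) ⟩
          L (λ γ → ∑ (subsets (∁ V ∩ U)) (λ B → P i B γ ⊛ Q j B)) f
            ≈⟨ trans (L-∑ (subsets (∁ V ∩ U)) f) (∑-cong (subsets (∁ V ∩ U)) λ B → L-scaleʳ _ f) ⟩
          ∑ (subsets (∁ V ∩ U)) (λ B → L (P i B) f ⊛ Q j B)
            ≈⟨ sym (∑-map _ (subsets (∁ V ∩ U))) ⟩
          _ ∎
      }
      where
      P : I → Subset N → Monomial N → Carrier
      P i B γ = product λ x → w (S x) (if lookup V x then r i x else lookup B x) (lookup γ x)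

      Q : J → Subset N → Carrier
      Q j B = product λ x → if lookup V x then 1# else δ (lookup B x) (c j x)

      expand : ∀ i j γ → OnlyVars (V ∪ U) γ →
               weights S (u i j) γ ≈ ∑ (subsets (∁ V ∩ U)) (λ B → P i B γ ⊛ Q j B)
      expand i j γ γ⊆ = product-expand (∁ V ∩ U)
        (λ x e → w (S x) (if lookup V x then r i x else e) (lookup γ x))
        (λ x e → if lookup V x then 1# else δ e (c j x))
        pointwise
        where
        pointwise : ∀ x → w (S x) (u i j x) (lookup γ x) ≈ ∑ (choices (lookup (∁ V ∩ U) x)) _
        pointwise x rewrite u≡ i j x | Vec.lookup-zipWith _∧_ x (∁ V) U | Vec.lookup-map x not V =
          w-select (S x) (lookup V x) (lookup U x) λ eq →
            ∉⇒exponent-0 {β = γ} γ⊆ x (≡.trans (Vec.lookup-zipWith _∨_ x V U) eq)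

    factor-product : ∀ {g h} → Supported V g → Supported U h →
      ∃[ k ] (2 ℕ.* k ℕ.≤ ∣ U ∣ × Factorisation (M (g *ₚ h)) (2 ℕ.^ k))
    factor-product {g} {h} (g′ , Vg , g≈) (h′ , Uh , h≈) = smaller (ℕ.≤-total ∣ V ∩ U ∣ ∣ ∁ V ∩ U ∣)
      where
      half : ∀ k → k ℕ.+ k ℕ.≤ ∣ V ∩ U ∣ ℕ.+ ∣ ∁ V ∩ U ∣ → 2 ℕ.* k ℕ.≤ ∣ U ∣
      half k = ≡.subst₂ ℕ._≤_ (≡.cong (k ℕ.+_) (≡.sym (ℕ.+-identityʳ k))) (∣p∩q∣+∣∁p∩q∣≡∣q∣ V U)

      to-support : ∀ i j → M (g *ₚ h) i j ≈ M (g′ *ₚ h′) i j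
      to-support i j = *ₚ-cong {f = g} {g′} {h} {h′} g≈ h≈ _

      smaller : ∣ V ∩ U ∣ ℕ.≤ ∣ ∁ V ∩ U ∣ ⊎ ∣ ∁ V ∩ U ∣ ℕ.≤ ∣ V ∩ U ∣ →
                ∃[ k ] (2 ℕ.* k ℕ.≤ ∣ U ∣ × Factorisation (M (g *ₚ h)) (2 ℕ.^ k))
      smaller (inj₁ ≤) = ∣ V ∩ U ∣ , half ∣ V ∩ U ∣ (ℕ.+-monoʳ-≤ ∣ V ∩ U ∣ ≤) ,
        factorisation-cong to-support (factor-rows Vg Uh)
      smaller (inj₂ ≥) = ∣ ∁ V ∩ U ∣ , half ∣ ∁ V ∩ U ∣ (ℕ.+-monoˡ-≤ ∣ ∁ V ∩ U ∣ ≥) ,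
        factorisation-cong to-support (factor-columns (only-*ₚ (All.map (λ α⊆V x → p⊆p∪q U ∘ α⊆V x) Vg) (All.map (λ β⊆U x → q⊆p∪q V U ∘ β⊆U x) Uh)))

  -- Branching programs

  module _ {m : ℕ} (B : ABP m) where

    open ABP B

    -- Shares its fold with `polynomial`, which is therefore a `pathSum` by definition.
    pathSum : ℕ → Fin size → Fin size → Poly m
    pathSum k u w = List.foldr (λ p f → pathWeight p +ₚ f) 0ₚ (pathsOfLength k u w)

    edgeWeight : Fin size → Fin size → Poly m
    edgeWeight u v with T? (edge u v)
    ... | yes e = weight e
    ... | no  _ = 0ₚ

    L-pathWeights : ∀ φ {u w} (ps : List (Path u w)) →
      L φ (List.foldr (λ p f → pathWeight p +ₚ f) 0ₚ ps) ≈ ∑ ps (L φ ∘ pathWeight)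
    L-pathWeights φ []       = ≈-refl
    L-pathWeights φ (p ∷ ps) = trans (∑-++ (pathWeight p)) (+-congˡ (L-pathWeights φ ps))

    L-pathsVia : ∀ k φ u w v →
      ∑ (pathsVia k u w v) (L φ ∘ pathWeight) ≈ L (φ ◃ pathSum k v w) (edgeWeight u v)
    L-pathsVia k φ u w v with T? (edge u v)
    ... | no  _ = ≈-refl
    ... | yes e = begin
      ∑ (List.map (e ∷_) ps) (L φ ∘ pathWeight)       ≈⟨ ∑-map (e ∷_) ps ⟩
      ∑ ps (λ p → L φ (weight e *ₚ pathWeight p))     ≈⟨ ∑-cong ps (λ p → L-*ₚ φ (weight e) (pathWeight p)) ⟩
      ∑ ps (λ p → L (φ ◃ pathWeight p) (weight e))    ≈⟨ sym (L-∑ ps (weight e)) ⟩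
      L (λ α → ∑ ps (λ p → (φ ◃ pathWeight p) α)) (weight e)
        ≈⟨ sym (L-cong (weight e) λ α → L-pathWeights _ ps) ⟩
      L (φ ◃ pathSum k v w) (weight e)                ∎
      where
      ps : List (Path v w)
      ps = pathsOfLength k v w

    vertices : List (Fin size)
    vertices = List.allFin size

    L-pathSum-suc : ∀ k φ u w →
      L φ (pathSum (suc k) u w) ≈ ∑ vertices λ v → L (φ ◃ pathSum k v w) (edgeWeight u v)
    L-pathSum-suc k φ u w = trans (L-pathWeights φ (pathsOfLength (suc k) u w))
      (trans (∑-concatMap (pathsVia k u w) vertices) (∑-cong vertices (L-pathsVia k φ u w)))

    -- A path of length k + l is cut at its vertex after k steps; in terms of the matrix of edge
    -- weights, powers add. The induction peels off the first edge.
    L-pathSum-+ : ∀ k l φ u w →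
      L φ (pathSum (k ℕ.+ l) u w) ≈ ∑ vertices λ v → L (φ ◃ pathSum l v w) (pathSum k u v)
    L-pathSum-+ zero l φ u w = sym (trans
      (∑-unique (Unique.allFin⁺ size) (List.∈-allFin u) off) on)
      where
      off : ∀ v → v ≢ u → L (φ ◃ pathSum l v w) (pathSum 0 u v) ≈ 0#
      off v v≢u with u Fin.≟ v
      ... | yes u≡v = contradiction (≡.sym u≡v) v≢u
      ... | no  _   = ≈-refl

      on : L (φ ◃ pathSum l u w) (pathSum 0 u u) ≈ L φ (pathSum l u w)
      on with u Fin.≟ u
      ... | no u≢u   = contradiction refl u≢u
      ... | yes refl = trans (+-identityʳ _) (trans (*-identityˡ _)
        (L-cong (pathSum l u w) λ β → reflexive (≡.cong φ (Vec.zipWith-identityˡ ℕ.+-identityˡ β))))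
    L-pathSum-+ (suc k) l φ u w = begin
      L φ (pathSum (suc (k ℕ.+ l)) u w)
        ≈⟨ L-pathSum-suc (k ℕ.+ l) φ u w ⟩
      ∑ vertices (λ v′ → L (φ ◃ pathSum (k ℕ.+ l) v′ w) (edgeWeight u v′))
        -- The induction hypothesis is applied to φ shifted by a monomial α of the first edge.
        ≈⟨ ∑-cong vertices (λ v′ → trans
             (L-cong (edgeWeight u v′) λ α → L-pathSum-+ k l _ v′ w) (L-∑ vertices (edgeWeight u v′))) ⟩
      ∑ vertices (λ v′ → ∑ vertices λ v →
        L (λ α → L ((λ β → φ (α ·ᵐ β)) ◃ pathSum l v w) (pathSum k v′ v)) (edgeWeight u v′))
        ≈⟨ ∑-comm vertices vertices ⟩
      ∑ vertices (λ v → ∑ vertices λ v′ →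
        L (λ α → L ((λ β → φ (α ·ᵐ β)) ◃ pathSum l v w) (pathSum k v′ v)) (edgeWeight u v′))
        ≈⟨ ∑-cong vertices (λ v → ∑-cong vertices λ v′ → L-cong (edgeWeight u v′) λ α →
             L-cong (pathSum k v′ v) λ β → L-cong (pathSum l v w) λ γ →
               reflexive (≡.cong φ (≡.sym (·ᵐ-assoc α β γ)))) ⟩
      ∑ vertices (λ v → ∑ vertices λ v′ → L (φ ◃ pathSum l v w ◃ pathSum k v′ v) (edgeWeight u v′))
        ≈⟨ sym (∑-cong vertices λ v → L-pathSum-suc k (φ ◃ pathSum l v w) u v) ⟩
      ∑ vertices (λ v → L (φ ◃ pathSum l v w) (pathSum (suc k) u v)) ∎

    -- Every edge raises the level by one. Hence a sum over all vertices can stand for the sum over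
    -- the cut level.
    pathSum-wrong-level : ∀ k φ u w → toℕ (level w) ≢ k ℕ.+ toℕ (level u) → L φ (pathSum k u w) ≈ 0#
    pathSum-wrong-level zero φ u w ≢ with u Fin.≟ w
    ... | yes refl = contradiction refl ≢
    ... | no  _    = ≈-refl
    pathSum-wrong-level (suc k) φ u w ≢ = trans (L-pathSum-suc k φ u w) (∑-zero vertices via)
      where
      via : ∀ v → L (φ ◃ pathSum k v w) (edgeWeight u v) ≈ 0#
      via v with T? (edge u v)
      ... | no  _ = ≈-refl
      ... | yes e = L-zero (weight e) λ α → pathSum-wrong-level k _ v w λ eq →
        ≢ (≡.trans eq (≡.trans (≡.cong (k ℕ.+_) (edge-levels e)) (ℕ.+-suc k _)))

    supported-pathWeight : ∀ {U u w} (p : Path u w) → (∀ x → OccursOn x p → x ∈ U) → Supported U (pathWeight p)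
    supported-pathWeight []      p⊆U = supported-1ₚ
    supported-pathWeight (e ∷ p) p⊆U = supported-*ₚ {f = weight e} {pathWeight p}
      (supported (weight e) λ x → p⊆U x ∘ inj₁) (supported-pathWeight p λ x → p⊆U x ∘ inj₂)

    supported-pathSum : ∀ {U} k u w → (∀ x → OccursBetween u w x → x ∈ U) → Supported U (pathSum k u w)
    supported-pathSum {U} k u w X⊆U = go (pathsOfLength k u w)
      where
      go : ∀ ps → Supported U (List.foldr (λ p f → pathWeight p +ₚ f) 0ₚ ps)
      go []       = supported-0ₚ
      go (p ∷ ps) = supported-+ₚ {f = pathWeight p} (supported-pathWeight p λ x x∈p → X⊆U x (p , x∈p)) (go ps)

    L-polynomial : ∀ (i : Fin (suc depth)) φ →
      L φ polynomial ≈ ∑ vertices λ v → L φ (pathSum (toℕ i) s v *ₚ pathSum (depth ∸ toℕ i) v t)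
    L-polynomial i φ = begin
      L φ (pathSum (toℕ (level t) ∸ toℕ (level s)) s t)
        ≡⟨ ≡.cong (λ k → L φ (pathSum k s t)) total ⟩
      L φ (pathSum (toℕ i ℕ.+ (depth ∸ toℕ i)) s t)
        ≈⟨ L-pathSum-+ (toℕ i) (depth ∸ toℕ i) φ s t ⟩
      ∑ vertices (λ v → L (φ ◃ pathSum (depth ∸ toℕ i) v t) (pathSum (toℕ i) s v))
        ≈⟨ sym (∑-cong vertices λ v → L-*ₚ φ (pathSum (toℕ i) s v) _) ⟩
      ∑ vertices (λ v → L φ (pathSum (toℕ i) s v *ₚ pathSum (depth ∸ toℕ i) v t)) ∎
      where
      total : toℕ (level t) ∸ toℕ (level s) ≡ toℕ i ℕ.+ (depth ∸ toℕ i)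
      total rewrite Equivalence.from (level-s s) refl | Equivalence.from (level-t t) refl =
        ≡.sym (ℕ.m+[n∸m]≡n (ℕ.s≤s⁻¹ (Fin.toℕ<n i)))

    L-off-level : ∀ (i : Fin (suc depth)) φ {g} v → level v ≢ i → L φ (pathSum (toℕ i) s v *ₚ g) ≈ 0#
    L-off-level i φ {g} v v∉Lᵢ = trans (L-*ₚ φ (pathSum (toℕ i) s v) g)
      (pathSum-wrong-level (toℕ i) (φ ◃ g) s v λ eq → v∉Lᵢ (Fin.toℕ-injective
        (≡.trans eq (≡.trans (≡.cong (toℕ i ℕ.+_) (Equivalence.from (level-s s) refl)) (ℕ.+-identityʳ _)))))

  -- Coefficient matrices

  -- One coordinate of a monomial that counts towards the entry at `u`: on `u` the exponent is
  -- positive and division lowers it by one, off `u` it is 0. `w-outer` is the opposite case.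
  w-inner : ∀ s {N} (u : Subset N) (γ : Monomial N) x →
    lookup (multilinear u) x ℕ.≤ lookup γ x → (0 ℕ.< lookup γ x → x ∈ u) →
    s ^ lookup (zipWith _∸_ γ (multilinear u)) x ≈ w s (lookup u x) (lookup γ x)
  w-inner s u γ x χ≤γ γ⊆u
    rewrite Vec.lookup-zipWith _∸_ x γ (multilinear u) | Vec.lookup-map x bit u
    with lookup u x in ux | lookup γ x
  ... | true  | suc k = ≈-refl
  ... | false | zero  = ≈-refl
  ... | false | suc k = contradiction (≡.trans (≡.sym (Vec.[]=⇒lookup (γ⊆u ℕ.z<s))) ux) λ ()

  w-outer : ∀ s {N} (u : Subset N) (γ : Monomial N) x →
    ¬ (lookup (multilinear u) x ℕ.≤ lookup γ x × (0 ℕ.< lookup γ x → x ∈ u)) →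
    w s (lookup u x) (lookup γ x) ≈ 0#
  w-outer s u γ x outer rewrite Vec.lookup-map x bit u with lookup u x in ux | lookup γ x
  ... | true  | zero  = ≈-refl
  ... | true  | suc k = contradiction (ℕ.s≤s ℕ.z≤n , λ _ → Vec.lookup⇒[]= x u ux) outer
  ... | false | zero  = contradiction (ℕ.z≤n , λ ()) outer
  ... | false | suc k = ≈-refl

  -- The decision procedure is a variable so that a case split on it can be
  -- traced inside quotient.
  eval-quotient : ∀ {N} S u (inner : ∀ t → Dec (Inner u t)) (f : Poly N) →
                  eval S (quotient u inner f) ≈ L (weights S (lookup u)) f
  eval-quotient S u inner []            = ≈-refl
  eval-quotient S u inner ((a , γ) ∷ f) with inner (a , γ)
  ... | yes (χ∣γ , γ⊆u) = +-cong
    (*-congˡ (Product.sum-cong-≋ λ x → w-inner (S x) u γ x (χ∣γ x) (γ⊆u x))) (eval-quotient S u inner f)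
  ... | no  outer = trans (eval-quotient S u inner f) (sym (trans (+-congʳ vanishes) (+-identityˡ _)))
    where
    -- The condition is decidable at each of finitely many coordinates, so its failure yields a
    -- concrete coordinate, whose zero weight kills the product.
    bad : ∃[ x ] ¬ (lookup (multilinear u) x ℕ.≤ lookup γ x × (0 ℕ.< lookup γ x → x ∈ u))
    bad = Fin.¬∀⟶∃¬ _ _
      (λ x → (lookup (multilinear u) x ℕ.≤? lookup γ x) ×-dec ((0 ℕ.<? lookup γ x) →-dec (x ∈? u)))
      λ all → outer ((λ x → proj₁ (all x)) , (λ x → proj₂ (all x)))

    vanishes : a ⊛ weights S (lookup u) γ ≈ 0#
    vanishes = let x , outerₓ = bad in trans
      (*-congˡ (product-zero {f = λ x → w (S x) (lookup u x) (lookup γ x)} x (w-outer (S x) u γ x outerₓ)))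
      (zeroʳ a)

  weights-rename : ∀ {m k} (A : Permutation m k) S u (f : Poly m) →
    L (weights S u) (rename A f) ≈ L (weights (S ∘ (A ⟨$⟩ʳ_)) (u ∘ (A ⟨$⟩ʳ_))) f
  weights-rename A S u f = trans (∑-map _ f) (L-cong f λ α → trans
    (Product.sum-permute (λ y → w (S y) (u y) (lookup (tabulate λ y → lookup α (A ⟨$⟩ˡ y)) y)) A)
    (Product.sum-cong-≋ λ x → reflexive (≡.cong (w (S (A ⟨$⟩ʳ x)) (u (A ⟨$⟩ʳ x)))
      (≡.trans (Vec.lookup∘tabulate (λ y → lookup α (A ⟨$⟩ˡ y)) (A ⟨$⟩ʳ x))
        (≡.cong (lookup α) (Perm.inverseˡ A))))))

  -- Summing over the vertices and concluding

  Factorisationᵈ : (ℕ → Set) → ∀ {I J : Set} → (I → J → Carrier) → Set (c ⊔ ℓ₁)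
  Factorisationᵈ D M = ∃[ k ] (D k × Factorisation M k)

  -- The bound 2^(n(1-α)) need not be an integer, so it enters as a predicate `D`. The common count
  -- l is the maximum of the individual ones; being one of them, or 0, it satisfies `D`.
  factorisation-∑ : ∀ {a} {A : Set a} {I J : Set} {D : ℕ → Set} {M : A → I → J → Carrier} →
    D 0 → (∀ x → Factorisationᵈ D (M x)) → ∀ xs →
    ∃[ l ] ∃[ k ] (D l × k ≤ length xs * l × Factorisation (λ i j → ∑ xs (λ x → M x i j)) k)
  factorisation-∑ D0 factor []       = 0 , 0 , D0 , ℕ.z≤n , factorisation-0
  factorisation-∑ {D = D} D0 factor (x ∷ xs) with factor x | factorisation-∑ D0 factor xs
  ... | k , Dk , f | l , k′ , Dl , k′≤ , g =
    k ℕ.⊔ l , k ℕ.+ k′ , [ (λ eq → ≡.subst D (≡.sym eq) Dk) , (λ eq → ≡.subst D (≡.sym eq) Dl) ]′ (ℕ.⊔-sel k l)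
    , ℕ.+-mono-≤ (ℕ.m≤m⊔n k l) (ℕ.≤-trans k′≤ (ℕ.*-monoʳ-≤ (length xs) (ℕ.m≤n⊔m k l)))
    , factorisation-+ f g

  module _ {n : ℕ} (π : Perm.Permutation′ (2 * n)) where

    private
      2n≡n+n : 2 * n ≡ n ℕ.+ n
      2n≡n+n = ≡.cong (n ℕ.+_) (ℕ.+-identityʳ n)

    -- The inverse of π moves variable π(j) to position j, so the first half of the partition
    -- becomes Y and the second Z.
    halves : Permutation (2 * n) (n ℕ.+ n)
    halves = Perm.flip π ∘ₚ Perm.cast-id 2n≡n+n

    side : Fin (2 * n) → Fin n ⊎ Fin n
    side x = splitAt n (halves ⟨$⟩ʳ x)

    firstHalf : Subset (2 * n)
    firstHalf = tabulate ([ const true , const false ]′ ∘ side)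

    toℕ-halves : ∀ j → toℕ (halves ⟨$⟩ʳ (π ⟨$⟩ʳ j)) ≡ toℕ j
    toℕ-halves j = ≡.trans (Fin.toℕ-cast 2n≡n+n _) (≡.cong toℕ (Perm.inverseˡ π))

    ∈-firstHalf : ∀ {x} → ∃[ j ] (toℕ j ℕ.< n × x ≡ π ⟨$⟩ʳ j) → x ∈ firstHalf
    ∈-firstHalf {x} (j , j<n , refl) = Vec.lookup⇒[]= x firstHalf (≡.trans (Vec.lookup∘tabulate _ x)
      (≡.cong [ const true , const false ]′
        (Fin.splitAt-< n (halves ⟨$⟩ʳ x) (≡.subst (ℕ._< n) (≡.sym (toℕ-halves j)) j<n))))

    ∈-secondHalf : ∀ {x} → ∃[ j ] (n ≤ toℕ j × x ≡ π ⟨$⟩ʳ j) → x ∈ ∁ firstHalf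
    ∈-secondHalf {x} (j , n≤j , refl) = Vec.lookup⇒[]= x (∁ firstHalf) (≡.trans (Vec.lookup-map x not firstHalf)
      (≡.cong not (≡.trans (Vec.lookup∘tabulate _ x) (≡.cong [ const true , const false ]′
        (Fin.splitAt-≥ n (halves ⟨$⟩ʳ x) (≡.subst (n ≤_) (≡.sym (toℕ-halves j)) n≤j))))))

    row column : Subset n → Fin (2 * n) → Bool
    row    p x = [ lookup p , const false ]′ (side x)
    column q x = [ const false , lookup q ]′ (side x)

    chosen : Subset n → Subset n → Fin (2 * n) → Bool
    chosen p q x = lookup (p Vec.++ q) (halves ⟨$⟩ʳ x)

    chosen-row-column : ∀ p q x → chosen p q x ≡ (if lookup firstHalf x then row p x else column q x)
    chosen-row-column p q x
      rewrite Vec.lookup-splitAt n p q (halves ⟨$⟩ʳ x)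
            | Vec.lookup∘tabulate ([ const true , const false ]′ ∘ side) x
      with side x
    ... | inj₁ _ = refl
    ... | inj₂ _ = refl

    chosen-column-row : ∀ q p x → chosen p q x ≡ (if lookup (∁ firstHalf) x then column q x else row p x)
    chosen-column-row q p x = ≡.trans (chosen-row-column p q x)
      (≡.sym (≡.trans (≡.cong (λ b → if b then column q x else row p x) (Vec.lookup-map x not firstHalf))
        (Bool.if-not (lookup firstHalf x))))

    module _ {α : ℚ} (0<α : 0ℚ < α) (B : ABP (2 * n)) (S : Fin (2 * n) → Carrier) where

      open ABP B

      private
        Vertex : Fin (suc depth) → Fin size → Subset n → Subset n → Carrier
        Vertex i v p q = L (weights S (chosen p q)) (pathSum B (toℕ i) s v *ₚ pathSum B (depth ∸ toℕ i) v t)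

      factor-vertex : ((i , _) : PartitionedBy {n} α B π) → ∀ v → Factorisationᵈ (^-Bound α n) (Vertex i v)
      factor-vertex (i , _ , partition) v with level v Fin.≟ i
      ... | no v∉Lᵢ = 0 , ^-bound-0 α n , factorisation-cong (λ p q → L-off-level B i _ v v∉Lᵢ) factorisation-0
      ... | yes v∈Lᵢ with partition v v∈Lᵢ
      ...   | inj₁ (X₁⊆ , U , X₂⊆U , |U|≤) =
        let k , 2k≤|U| , D = factor-product S firstHalf U chosen-row-column
              {pathSum B (toℕ i) s v} {pathSum B (depth ∸ toℕ i) v t}
              (supported-pathSum B (toℕ i) s v λ x → ∈-firstHalf ∘ X₁⊆ x)
              (supported-pathSum B (depth ∸ toℕ i) v t X₂⊆U)
        in 2 ℕ.^ k , ^-bound α n _ k 0<α |U|≤ 2k≤|U| , D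
      -- Now the part from v to t lies in one half, so it takes the role of g: the factors are
      -- commuted and the factorisation is transposed back.
      ...   | inj₂ (X₂⊆ , U , X₁⊆U , |U|≤) =
        let k , 2k≤|U| , D = factor-product S (∁ firstHalf) U chosen-column-row
              {pathSum B (depth ∸ toℕ i) v t} {pathSum B (toℕ i) s v}
              (supported-pathSum B (depth ∸ toℕ i) v t λ x → ∈-secondHalf ∘ X₂⊆ x)
              (supported-pathSum B (toℕ i) s v X₁⊆U)
        in 2 ℕ.^ k , ^-bound α n _ k 0<α |U|≤ 2k≤|U| ,
           factorisation-cong (λ p q → L-*ₚ-comm _ (pathSum B (toℕ i) s v) (pathSum B (depth ∸ toℕ i) v t))
             (factorisation-transpose D)

    partitioned-size : ∀ {α} → 0ℚ < α → (f : Poly (2 * n)) → FullMaxRank {n} f →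
      (B : ABP (2 * n)) → PartitionedBy {n} α B π → B Computes f → 2^[ α · n ]≤ ABP.size B
    partitioned-size {α} 0<α f full B partition@(i , _) computes =
      -- Full max-rank at `halves` supplies an evaluation S and 2^n independent columns; `S′` below
      -- is S pulled back to the original variables.
      let (S , (col , independent) , _) , _ = full halves
          S′ = S ∘ (halves ⟨$⟩ʳ_)
          l , k , small , k≤ , D = factorisation-∑ (^-bound-0 α n) (factor-vertex 0<α B S′ partition) (vertices B)
          -- Each entry is a functional of the renamed f, then of f, then of the polynomial of `B`,
          -- and finally a sum over the vertices of the cut.
          matrix : ∀ p q → eval S (coeffMatrix {n} {n} (rename halves f) p q) ≈ _
          matrix p q = trans (eval-quotient S (p Vec.++ q) (inner? (p Vec.++ q)) (rename halves f))
            (trans (weights-rename halves S (lookup (p Vec.++ q)) f)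
              (trans (sym (≈ₚ⇒≈ₗ {f = ABP.polynomial B} {f} computes (weights S′ (chosen p q))))
                (L-polynomial B i _)))
          2ⁿ≤k = independent⇒≤ (factorisation-cong matrix D) col independent
      in ^-bound⇒2^≤ α n (ABP.size B) l small (ℕ.≤-trans 2ⁿ≤k
           (≡.subst (λ size → k ≤ size * l) (List.length-tabulate {n = ABP.size B} (λ v → v)) k≤))

theorem9 : ∀ {c ℓ₁ ℓ₂} (α : ℚ) → 0ℚ < α →
    ∃[ κ ] ∃[ n₀ ] (0ℚ < κ ×
    (∀ (n : ℕ) → n₀ ≤ n → (F : HeytingField c ℓ₁ ℓ₂) →
    let open OverField F in
    (f : Poly (2 * n)) → Homogeneous n f → FullMaxRank {n} f →
    (B : ABP (2 * n)) → HomogeneousABP B → Partitioned {n} α B → B Computes f →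
    2^[ κ · n ]≤ ABP.size B))
-- The estimate holds for every n, hence the threshold 0.
theorem9 α 0<α = α , 0 , 0<α , λ n _ F f _ full B _ (π , partition) →
  LowerBound.partitioned-size F {n} π 0<α f full B partition
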